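{- Let $U$ be a linear numeration system satisfying (H1), (H2) and (H3), and such that the gcd of the coefficients $a_0,\ldots,a_{k-1}$ of its linear recurrence relation is $1$. Then the following problem is decidable: given a deterministic finite automaton $\mathcal{A}$ over $A_U$ whose accepted language $L$ is contained in $\operatorname{rep}_U(\mathbb{N})$, decide whether the set $X=\{\operatorname{val}_U(w): w\in L\}\subseteq\mathbb{N}$ recognized by $\mathcal{A}$ is ultimately periodic.
   Context: A numeration system is an increasing sequence $U=(U_i)_{i\ge0}$ of integers with $U_0=1$ such that $C_U=\sup_{i\ge0}\lceil U_{i+1}/U_i\rceil$ is finite; $A_U=\{0,\ldots,C_U-1\}$. For $n\ge1$, the greedy $U$-representation $\operatorname{rep}_U(n)=w_\ell\cdots w_0$ (most significant digit first) is the unique word over $A_U$ with $n=\sum_{i=0}^\ell w_iU_i$, $w_\ell\neq0$ and $\sum_{i=0}^t w_iU_i<U_{t+1}$ for $t=0,\ldots,\ell$; $\operatorname{rep}_U(0)$ is the empty word. For a word $x=x_\ell\cdots x_0$ of integers, $\operatorname{val}_U(x)=\sum_{i=0}^\ell x_iU_i$. $U$ is linear if there exist $k\ge1$, integers $a_0,\ldots,a_{k-1}$ with $a_0\ne0$, and $N\ge0$ such that $U_{i+k}=a_{k-1}U_{i+k-1}+\cdots+a_0U_i$ for all $i\ge N$, where $k$ and then $N$ are chosen minimal; $a_0,\ldots,a_{k-1}$ are the coefficients of the recurrence relation. Hypotheses: (H1) the language $\operatorname{rep}_U(\mathbb{N})$ is regular; (H2) $\limsup_{i\to\infty}(U_{i+1}-U_i)=+\infty$;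 (H3) there exists $G\ge0$ such that $U_{i+1}-U_i\le U_{i+2}-U_{i+1}$ for all $i\ge G$. A set $X\subseteq\mathbb{N}$ is ultimately periodic if it is a finite union of arithmetic progressions and a finite set, i.e. its characteristic sequence is of the form $uv^\omega$ for finite words $u,v$. The numeration system is assumed to be given effectively (recurrence relation and initial terms), together with the constant $G$ of (H3). -}

module Defs where

open import Data.Nat using (ℕ; zero; suc; _+_; _*_; _∸_; _≤_; _<_)
open import Data.Nat.GCD using (gcd)
open import Data.Integer as ℤ using (ℤ; +_; ∣_∣)
open import Data.Fin using (Fin; toℕ) renaming (zero to fzero; suc to fsuc)
open import Data.List using (List; []; _∷_; reverse; take; length)
open import Data.Bool using (Bool; true)
open import Data.Product using (Σ; _×_; ∃)
open import Data.Sum using (_⊎_)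
open import Relation.Binary.PropositionalEquality using (_≡_; _≢_)
open import Function.Bundles using (_⇔_)

sumFinℤ : (k : ℕ) → (Fin k → ℤ) → ℤ
sumFinℤ zero    f = + 0
sumFinℤ (suc k) f = f fzero ℤ.+ sumFinℤ k (λ j → f (fsuc j))

gcdFin : (k : ℕ) → (Fin k → ℤ) → ℕ
gcdFin zero    f = 0
gcdFin (suc k) f = gcd ∣ f fzero ∣ (gcdFin k (λ j → f (fsuc j)))

-- Linear recurrence: U (i + k) = Σ_{j<k} a_j U (i + j) for all i ≥ N,
-- with k = suc m ≥ 1; a j is the coefficient a_j of U_{i+j}.

Recurrence : (U : ℕ → ℕ) (m : ℕ) (a : Fin (suc m) → ℤ) (N : ℕ) → Set
Recurrence U m a N =
  ∀ i → N ≤ i → + U (i + suc m) ≡ sumFinℤ (suc m) (λ j → a j ℤ.* + U (i + toℕ j))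

record LinearNumerationSystem : Set where
  field
    U        : ℕ → ℕ
    U0≡1     : U 0 ≡ 1
    U-incr   : ∀ i → U i < U (suc i)
    -- C = C_U = sup_i ⌈U_{i+1}/U_i⌉ (finite). Since U_i > 0:
    -- ⌈U_{i+1}/U_i⌉ ≤ C  ⇔  U_{i+1} ≤ C * U_i, and the sup is attained.
    C        : ℕ
    C-bound  : ∀ i → U (suc i) ≤ C * U i
    C-sharp  : ∃ λ i → (C ∸ 1) * U i < U (suc i)
    m        : ℕ
    a        : Fin (suc m) → ℤ
    N        : ℕ
    a₀≢0     : a fzero ≢ + 0
    rec      : Recurrence U m a N
    k-min    : ∀ m' (a' : Fin (suc m') → ℤ) N' → a' fzero ≢ + 0 →
               Recurrence U m' a' N' → m ≤ m'
    N-min    : ∀ (a' : Fin (suc m) → ℤ) N' → a' fzero ≢ + 0 →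
               Recurrence U m a' N' → N ≤ N'

open LinearNumerationSystem public

-- Words over A_U = Fin C, most significant digit first.

Word : LinearNumerationSystem → Set
Word S = List (Fin (C S))

valLSB : (S : LinearNumerationSystem) → ℕ → Word S → ℕ
valLSB S i []       = 0
valLSB S i (d ∷ ds) = toℕ d * U S i + valLSB S (suc i) ds

val : (S : LinearNumerationSystem) → Word S → ℕ
val S w = valLSB S 0 (reverse w)

GreedyLSB : (S : LinearNumerationSystem) → Word S → Set
GreedyLSB S ds = ∀ t → t < length ds → valLSB S 0 (take (suc t) ds) < U S (suc t)

-- w ∈ rep_U(ℕ): w is the empty word (= rep_U 0) or w is the greedy
-- representation of val_U w ≥ 1 (leading digit nonzero, greedy condition).
InRep : (S : LinearNumerationSystem) → Word S → Set
InRep S w = (w ≡ []) ⊎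
  (Σ (Fin (C S)) λ d → Σ (Word S) λ ws →
     (w ≡ d ∷ ws) × (toℕ d ≢ 0) × GreedyLSB S (reverse w))

record DFA (c : ℕ) : Set where
  field
    nStates : ℕ
    start   : Fin nStates
    δ       : Fin nStates → Fin c → Fin nStates
    final   : Fin nStates → Bool

open DFA public

run : ∀ {c} (A : DFA c) → Fin (nStates A) → List (Fin c) → Fin (nStates A)
run A q []       = q
run A q (x ∷ xs) = run A (δ A q x) xs

Accepts : ∀ {c} → DFA c → List (Fin c) → Set
Accepts A w = final A (run A (start A) w) ≡ true

H1 : LinearNumerationSystem → Set
H1 S = Σ (DFA (C S)) λ A → ∀ w → Accepts A w ⇔ InRep S w

H2 : LinearNumerationSystem → Set
H2 S = ∀ (B i : ℕ) → ∃ λ j → i ≤ j × B < U S (suc j) ∸ U S j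

H3 : LinearNumerationSystem → ℕ → Set
H3 S G = ∀ i → G ≤ i → U S (suc i) ∸ U S i ≤ U S (suc (suc i)) ∸ U S (suc i)

Recognized : (S : LinearNumerationSystem) → DFA (C S) → ℕ → Set
Recognized S A n = Σ (Word S) λ w → Accepts A w × val S w ≡ n

-- characteristic sequence of the form u v^ω with v nonempty
UltimatelyPeriodic : (ℕ → Set) → Set
UltimatelyPeriodic X = Σ ℕ λ n₀ → Σ ℕ λ p → 0 < p × (∀ n → n₀ ≤ n → (X n ⇔ X (n + p)))

{-# OPTIONS --safe #-}
module Submission where

-- If X has eventual period π and two prefixes x, x′ (placed before ℓ low-order digits) lead the automaton to
-- the same state, then the difference of their values is again an eventual period. Prefixes 10…010…0 with
-- sparse digits 1 are greedy by (H2) and (H3), and their values realize mod π all multiples of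
-- g = gcd(π, U_i, U_{i+1}, …), i large. So a period π > g · #states can be decreased.
--
-- The eventual common divisors g are bounded independently of π: by minimality of k the Hankel matrix
-- (U_{N+i+j}) is invertible over ℚ (otherwise Fatou's lemma yields a shorter integer recurrence), so some
-- integer combination V of shifts of U is r ≠ 0 times the impulse response of the recurrence. As the
-- coefficients have gcd 1, a prime dividing V eventually divides r, and cancelling it shows g ∣ r.
--
-- A given π is an eventual period iff in each class mod π either X or its complement has only finitely many
-- elements; the possible lengths of the accepted words in a class form an eventually periodic set.

open import Defs
open import Data.Nat as ℕ using (ℕ; zero; suc; z≤n; s≤s)
import Data.Nat.Properties as ℕ
import Data.Nat.Divisibility as ℕ∣
open import Data.Nat.Induction using (<-rec)
open import Data.Nat.GCD using (gcd; gcd-greatest; gcd[m,n]∣m; gcd[m,n]∣n; gcd-GCD; module Bézout)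
open import Data.Nat.ListAction using (product)
open import Data.Nat.Primality using (Prime; euclidsLemma; prime⇒nonZero; prime⇒nonTrivial)
open import Data.Nat.Primality.Factorisation using (factorise)
open import Data.Bool using (true; false; _∧_; not)
import Data.Bool as Bool
open import Data.Empty using (⊥; ⊥-elim)
open import Data.Fin using (Fin; toℕ; fromℕ<; combine; remQuot; funToFin; finToFun) renaming (zero to fzero; suc to fsuc)
open import Data.Fin.Patterns using (0F; 1F)
open import Data.Fin.Properties using
  (toℕ-injective; toℕ-fromℕ<; fromℕ<-injective; toℕ<n; pigeonhole; any?; remQuot-combine; combine-injective; finToFun-funToFin)
open import Data.List using ([]; _∷_; _++_; _∷ʳ_; length; reverse; replicate; take)
open import Data.List.Properties using (unfold-reverse; length-reverse; length-++; ++-assoc; take-all; length-replicate)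
open import Data.List.Relation.Unary.All using (_∷_)
open import Data.Product using (∃; ∃₂; _×_; _,_; proj₁; proj₂)
open import Data.Sum using (_⊎_; inj₁; inj₂)
open import Data.Unit using (⊤; tt)
open import Function using (_∘_)
open import Function.Bundles using (_⇔_; mk⇔; Equivalence)
open import Function.Construct.Composition using (_⇔-∘_)
open import Function.Construct.Symmetry using (⇔-sym)
open import Relation.Binary.Definitions using (tri<; tri≈; tri>)
open import Relation.Binary.PropositionalEquality
open import Relation.Nullary using (¬_; Dec; yes; no; contradiction; _×-dec_)
open import Relation.Nullary.Decidable using (map′)

-- The bound on the eventual common divisors must not depend on the candidate period, and this is
-- what gcd 1 provides: if a prime divided every coefficient, each of its powers would divide all
-- late `U i`, and no bound `R` could exist. Given `R`, let s be the number of states and let π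
-- exceed s * R. The multiples t * g with t ≤ s then stay below π, so they are distinct modulo π,
-- while two of the s + 1 prefixes realizing them must share a state. Hence an ultimately periodic X
-- has a period at most s * R, and a finite search remains. The obstacle is the form of minimality:
-- `k-min` speaks of integer recurrences with leading coefficient 1, while a singular Hankel matrix
-- yields only a relation with an arbitrary leading coefficient. The linear algebra stays in ℤ, with
-- nonzero multipliers in place of denominators, and Fatou's lemma then normalises the leading
-- coefficient.

U-positive : ∀ S i → 0 ℕ.< U S i
U-positive S zero    = subst (0 ℕ.<_) (sym (U0≡1 S)) ℕ.z<s
U-positive S (suc i) = ℕ.<-trans (U-positive S i) (U-incr S i)

firstCounterexample : {P : ℕ → Set} → (∀ i → Dec (P i)) → ∀ n →
  (∀ i → i ℕ.< n → P i) ⊎ (∃ λ m → m ℕ.< n × ¬ P m × (∀ i → i ℕ.< m → P i))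
firstCounterexample P? zero = inj₁ λ _ ()
firstCounterexample P? (suc n) with firstCounterexample P? n
... | inj₂ (m , m<n , ¬Pm , below) = inj₂ (m , ℕ.m<n⇒m<1+n m<n , ¬Pm , below)
... | inj₁ all with P? n
...   | no ¬Pn = inj₂ (n , ℕ.≤-refl , ¬Pn , all)
...   | yes Pn = inj₁ λ i i<1+n → case-≤ i (ℕ.m≤n⇒m<n∨m≡n (ℕ.s≤s⁻¹ i<1+n))
  where
  case-≤ : ∀ i → i ℕ.< n ⊎ i ≡ n → _
  case-≤ i (inj₁ i<n)  = all i i<n
  case-≤ i (inj₂ refl) = Pn

lastCounterexample : {P : ℕ → Set} → (∀ i → Dec (P i)) → ∀ n →
  (∀ i → i ℕ.< n → P i) ⊎ (∃ λ m → m ℕ.< n × ¬ P m × (∀ i → m ℕ.< i → i ℕ.< n → P i))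
lastCounterexample P? zero = inj₁ λ _ ()
lastCounterexample {P} P? (suc n) with P? n
... | no ¬Pn = inj₂ (n , ℕ.≤-refl , ¬Pn , λ i n<i i<1+n → contradiction n<i (ℕ.≤⇒≯ (ℕ.s≤s⁻¹ i<1+n)))
... | yes Pn with lastCounterexample P? n
...   | inj₁ all = inj₁ λ i i<1+n → extend i (ℕ.m≤n⇒m<n∨m≡n (ℕ.s≤s⁻¹ i<1+n))
  where
  extend : ∀ i → i ℕ.< n ⊎ i ≡ n → P i
  extend i (inj₁ i<n)  = all i i<n
  extend i (inj₂ refl) = Pn
...   | inj₂ (m , m<n , ¬Pm , above) =
  inj₂ (m , ℕ.m<n⇒m<1+n m<n , ¬Pm , λ i m<i i<1+n → extend i m<i (ℕ.m≤n⇒m<n∨m≡n (ℕ.s≤s⁻¹ i<1+n)))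
  where
  extend : ∀ i → m ℕ.< i → i ℕ.< n ⊎ i ≡ n → P i
  extend i m<i (inj₁ i<n)  = above i m<i i<n
  extend i m<i (inj₂ refl) = Pn

primeDivisor : ∀ n → 1 ℕ.< n → ∃ λ p → Prime p × p ℕ∣.∣ n
primeDivisor n@(suc _) 1<n with factorise n
... | record { factors = [] ; isFactorisation = n≡1 } = contradiction (sym n≡1) (ℕ.<⇒≢ 1<n)
... | record { factors = p ∷ ps ; isFactorisation = n≡p*ps ; factorsPrime = p-prime ∷ _ } =
  p , p-prime , ℕ∣.divides (product ps) (trans n≡p*ps (ℕ.*-comm p (product ps)))

module IntegerRecurrences where
  open import Data.Integer as ℤ hiding (suc)
  open import Data.Integer.Properties
  open import Data.Integer.Divisibility.Signed
  open import Data.Integer.Tactic.RingSolver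

  -- Finite sums, and linear algebra over ℤ without fractions.

  ∑ : ℕ → (ℕ → ℤ) → ℤ
  ∑ zero    f = 0ℤ
  ∑ (suc n) f = ∑ n f + f n

  ∑-cong : ∀ n {f g : ℕ → ℤ} → (∀ j → j ℕ.< n → f j ≡ g j) → ∑ n f ≡ ∑ n g
  ∑-cong zero    eq = refl
  ∑-cong (suc n) eq = cong₂ _+_ (∑-cong n λ j j<n → eq j (ℕ.m<n⇒m<1+n j<n)) (eq n ℕ.≤-refl)

  ∑-zero : ∀ n {f : ℕ → ℤ} → (∀ j → j ℕ.< n → f j ≡ 0ℤ) → ∑ n f ≡ 0ℤ
  ∑-zero zero    eq = refl
  ∑-zero (suc n) eq = cong₂ _+_ (∑-zero n λ j j<n → eq j (ℕ.m<n⇒m<1+n j<n)) (eq n ℕ.≤-refl)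

  ∑-+ : ∀ n f g → ∑ n (λ j → f j + g j) ≡ ∑ n f + ∑ n g
  ∑-+ zero    f g = refl
  ∑-+ (suc n) f g rewrite ∑-+ n f g = interchange (∑ n f) (∑ n g) (f n) (g n)
    where
    interchange : ∀ a b c d → (a + b) + (c + d) ≡ (a + c) + (b + d)
    interchange = solve-∀

  *-distribˡ-∑ : ∀ n c f → c * ∑ n f ≡ ∑ n (λ j → c * f j)
  *-distribˡ-∑ zero    c f = *-zeroʳ c
  *-distribˡ-∑ (suc n) c f = trans (*-distribˡ-+ c (∑ n f) (f n)) (cong (_+ c * f n) (*-distribˡ-∑ n c f))

  *-distribʳ-∑ : ∀ n c f → ∑ n f * c ≡ ∑ n (λ j → f j * c)
  *-distribʳ-∑ zero    c f = *-zeroˡ c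
  *-distribʳ-∑ (suc n) c f = trans (*-distribʳ-+ c (∑ n f) (f n)) (cong (_+ f n * c) (*-distribʳ-∑ n c f))

  ∑-swap : ∀ m n (F : ℕ → ℕ → ℤ) → ∑ m (λ i → ∑ n (F i)) ≡ ∑ n (λ j → ∑ m (λ i → F i j))
  ∑-swap zero    n F = sym (∑-zero n λ _ _ → refl)
  ∑-swap (suc m) n F =
    trans (cong (_+ ∑ n (F m)) (∑-swap m n F)) (sym (∑-+ n (λ j → ∑ m (λ i → F i j)) (F m)))

  ∑-∣ : ∀ n {q f} → (∀ j → j ℕ.< n → q ∣ f j) → q ∣ ∑ n f
  ∑-∣ zero    q∣f = divides 0ℤ refl
  ∑-∣ (suc n) q∣f = ∣m∣n⇒∣m+n (∑-∣ n λ j j<n → q∣f j (ℕ.m<n⇒m<1+n j<n)) (q∣f n ℕ.≤-refl)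

  ∑-∣-isolate : ∀ n {q f p} → p ℕ.< n → (∀ j → j ℕ.< n → j ≢ p → q ∣ f j) → q ∣ ∑ n f → q ∣ f p
  ∑-∣-isolate (suc n) {q} {f} {p} p<1+n others q∣∑ with ℕ.m≤n⇒m<n∨m≡n (ℕ.s≤s⁻¹ p<1+n)
  ... | inj₂ refl = ∣m+n∣m⇒∣n q∣∑ (∑-∣ n λ j j<n → others j (ℕ.m<n⇒m<1+n j<n) (ℕ.<⇒≢ j<n))
  ... | inj₁ p<n = ∑-∣-isolate n p<n (λ j j<n → others j (ℕ.m<n⇒m<1+n j<n))
                     (∣m+n∣n⇒∣m {m = ∑ n f} q∣∑ (others n ℕ.≤-refl (ℕ.<⇒≢ p<n ∘ sym)))

  ∑-single : ∀ n {f p} → p ℕ.< n → (∀ j → j ℕ.< n → j ≢ p → f j ≡ 0ℤ) → ∑ n f ≡ f p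
  ∑-single (suc n) {f} {p} p<1+n others with ℕ.m≤n⇒m<n∨m≡n (ℕ.s≤s⁻¹ p<1+n)
  ... | inj₂ refl = trans (cong (_+ f n) (∑-zero n λ j j<n → others j (ℕ.m<n⇒m<1+n j<n) (ℕ.<⇒≢ j<n))) (+-identityˡ (f n))
  ... | inj₁ p<n = trans (cong₂ _+_ (∑-single n p<n (λ j j<n → others j (ℕ.m<n⇒m<1+n j<n)))
                                    (others n ℕ.≤-refl (ℕ.<⇒≢ p<n ∘ sym)))
                         (+-identityʳ (f p))

  unit : ℕ → ℕ → ℤ
  unit p i with i ℕ.≟ p
  ... | yes _ = 1ℤ
  ... | no  _ = 0ℤ

  unit-diag : ∀ p → unit p p ≡ 1ℤ
  unit-diag p with p ℕ.≟ p
  ... | yes _   = refl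
  ... | no p≢p = contradiction refl p≢p

  unit-off : ∀ p i → i ≢ p → unit p i ≡ 0ℤ
  unit-off p i i≢p with i ℕ.≟ p
  ... | yes i≡p = contradiction i≡p i≢p
  ... | no  _   = refl

  ∑-unit : ∀ n p (f : ℕ → ℤ) → p ℕ.< n → ∑ n (λ i → unit p i * f i) ≡ f p
  ∑-unit n p f p<n =
    trans (∑-single n p<n λ j _ j≢p → trans (cong (_* f j) (unit-off p j j≢p)) (*-zeroˡ (f j)))
          (trans (cong (_* f p) (unit-diag p)) (*-identityˡ (f p)))

  -- The two sides of the Fredholm alternative; `r` is the common denominator of a rational
  -- solution.
  Solvable Obstructed : ℕ → ℕ → (ℕ → ℕ → ℤ) → (ℕ → ℤ) → Set
  Solvable n k H e = ∃ λ (α : ℕ → ℤ) → ∃ λ r → r ≢ 0ℤ × (∀ i → i ℕ.< n → ∑ k (λ j → H i j * α j) ≡ r * e i)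
  Obstructed n k H e = ∃ λ (β : ℕ → ℤ) → (∀ j → j ℕ.< k → ∑ n (λ i → β i * H i j) ≡ 0ℤ) × ∑ n (λ i → β i * e i) ≢ 0ℤ

  *-nonzero : ∀ {a b} → a ≢ 0ℤ → b ≢ 0ℤ → a * b ≢ 0ℤ
  *-nonzero {a} a≢0 b≢0 ab≡0 with i*j≡0⇒i≡0∨j≡0 a ab≡0
  ... | inj₁ a≡0 = a≢0 a≡0
  ... | inj₂ b≡0 = b≢0 b≡0

  -- Fraction-free elimination of column `k` with pivot `h` in row `p`. Row `p` of the reduced
  -- system becomes zero on both sides, so it can stay and the number of rows does not change.
  module Elimination (n k : ℕ) (H : ℕ → ℕ → ℤ) (e : ℕ → ℤ) (p : ℕ) (p<n : p ℕ.< n) where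
    h = H p k

    H′ : ℕ → ℕ → ℤ
    H′ i j = h * H i j - H i k * H p j

    e′ : ℕ → ℤ
    e′ i = h * e i - H i k * e p

    lift-solution : h ≢ 0ℤ → Solvable n k H′ e′ → Solvable n (suc k) H e
    lift-solution h≢0 (α′ , r , r≢0 , sol) = α , h * r , *-nonzero h≢0 r≢0 , solves
      where
      -- Back-substitution in row `p`: scaling `α′` and `r` by `h` makes the division by the pivot
      -- exact.
      top : ℤ
      top = r * e p - ∑ k (λ j → H p j * α′ j)

      α : ℕ → ℤ
      α j with j ℕ.<? k
      ... | yes _ = h * α′ j
      ... | no  _ = top

      α-below : ∀ j → j ℕ.< k → α j ≡ h * α′ j
      α-below j j<k with j ℕ.<? k
      ... | yes _  = refl
      ... | no j≮k = contradiction j<k j≮k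

      α-top : α k ≡ top
      α-top with k ℕ.<? k
      ... | yes k<k = contradiction k<k (ℕ.n≮n k)
      ... | no  _   = refl

      regroup : ∀ h a b s → h * a ≡ (h * a - b * s) + b * s
      regroup = solve-∀

      solves : ∀ i → i ℕ.< n → ∑ (suc k) (λ j → H i j * α j) ≡ h * r * e i
      solves i i<n = begin
        ∑ k (λ j → H i j * α j) + H i k * α k
          ≡⟨ cong₂ _+_ (∑-cong k λ j j<k → trans (cong (H i j *_) (α-below j j<k)) (entry (H i j) h (α′ j) (H i k) (H p j)))
                       (cong (H i k *_) α-top) ⟩
        ∑ k (λ j → H′ i j * α′ j + H i k * (H p j * α′ j)) + H i k * top
          ≡⟨ cong (_+ H i k * top) (∑-+ k _ _) ⟩
        ∑ k (λ j → H′ i j * α′ j) + ∑ k (λ j → H i k * (H p j * α′ j)) + H i k * top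
          ≡⟨ cong₂ (λ x y → x + y + H i k * top) (sol i i<n) (sym (*-distribˡ-∑ k (H i k) _)) ⟩
        r * e′ i + H i k * S + H i k * (r * e p - S)
          ≡⟨ total r h (e i) (H i k) (e p) S ⟩
        h * r * e i ∎
        where
        open ≡-Reasoning
        S = ∑ k (λ j → H p j * α′ j)
        entry : ∀ a h x b c → a * (h * x) ≡ (h * a - b * c) * x + b * (c * x)
        entry = solve-∀
        total : ∀ r h ei b ep S → r * (h * ei - b * ep) + b * S + b * (r * ep - S) ≡ h * r * ei
        total = solve-∀

    lift-obstruction : Obstructed n k H′ e′ → Obstructed n (suc k) H e
    lift-obstruction (β′ , kills , ≢0) = β , kills-H , λ eq → ≢0 (trans (sym (pairing e)) eq)
      where
      B = ∑ n (λ i → β′ i * H i k)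

      β : ℕ → ℤ
      β i = h * β′ i - unit p i * B

      -- `β` is the image of `β′` under the transpose of the elimination map on columns. Both
      -- properties of `β` are thus read off from the eliminated columns, column `k` itself being
      -- eliminated to zero.
      pairing : ∀ (v : ℕ → ℤ) → ∑ n (λ i → β i * v i) ≡ ∑ n (λ i → β′ i * (h * v i - H i k * v p))
      pairing v = begin
        ∑ n (λ i → β i * v i)
          ≡⟨ ∑-cong n (λ i _ → expandˡ h (β′ i) (unit p i) B (v i)) ⟩
        ∑ n (λ i → h * (β′ i * v i) + - B * (unit p i * v i))
          ≡⟨ ∑-+ n _ _ ⟩
        ∑ n (λ i → h * (β′ i * v i)) + ∑ n (λ i → - B * (unit p i * v i))
          ≡⟨ cong (λ x → ∑ n (λ i → h * (β′ i * v i)) + x) (sym (*-distribˡ-∑ n (- B) _)) ⟩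
        ∑ n (λ i → h * (β′ i * v i)) + - B * ∑ n (λ i → unit p i * v i)
          ≡⟨ cong (λ x → ∑ n (λ i → h * (β′ i * v i)) + - B * x) (∑-unit n p v p<n) ⟩
        ∑ n (λ i → h * (β′ i * v i)) + - B * v p
          ≡⟨ cong (λ x → ∑ n (λ i → h * (β′ i * v i)) + x) (trans (rearrange B (v p)) (*-distribʳ-∑ n (- v p) _)) ⟩
        ∑ n (λ i → h * (β′ i * v i)) + ∑ n (λ i → β′ i * H i k * - v p)
          ≡⟨ sym (∑-+ n _ _) ⟩
        ∑ n (λ i → h * (β′ i * v i) + β′ i * H i k * - v p)
          ≡⟨ ∑-cong n (λ i _ → collect h (β′ i) (v i) (H i k) (v p)) ⟩
        ∑ n (λ i → β′ i * (h * v i - H i k * v p)) ∎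
        where
        open ≡-Reasoning
        expandˡ : ∀ h b u B v → (h * b - u * B) * v ≡ h * (b * v) + - B * (u * v)
        expandˡ = solve-∀
        rearrange : ∀ B v → - B * v ≡ B * - v
        rearrange = solve-∀
        collect : ∀ h b v c w → h * (b * v) + b * c * - w ≡ b * (h * v - c * w)
        collect = solve-∀

      kills-H : ∀ j → j ℕ.< suc k → ∑ n (λ i → β i * H i j) ≡ 0ℤ
      kills-H j j<1+k with ℕ.m≤n⇒m<n∨m≡n (ℕ.s≤s⁻¹ j<1+k)
      ... | inj₁ j<k  = trans (pairing (λ i → H i j)) (kills j j<k)
      ... | inj₂ refl = trans (pairing (λ i → H i k)) (∑-zero n λ i _ → cancel (β′ i) h (H i k))
        where
        cancel : ∀ b h x → b * (h * x - x * h) ≡ 0ℤ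
        cancel = solve-∀

  -- Induction on the number of columns: a nonzero entry of the last column serves as pivot, and a
  -- zero column affects neither alternative. Without columns, a nonzero entry of `e` is an
  -- obstruction by itself.
  fredholm : ∀ n k H e → Solvable n k H e ⊎ Obstructed n k H e
  fredholm n zero H e with firstCounterexample (λ i → e i ≟ 0ℤ) n
  ... | inj₁ e≡0 = inj₁ ((λ _ → 0ℤ) , 1ℤ , (λ ()) , λ i i<n → sym (trans (*-identityˡ (e i)) (e≡0 i i<n)))
  ... | inj₂ (p , p<n , ep≢0 , _) = inj₂ (unit p , (λ _ ()) , λ eq → ep≢0 (trans (sym (∑-unit n p e p<n)) eq))
  fredholm n (suc k) H e with firstCounterexample (λ i → H i k ≟ 0ℤ) n
  ... | inj₂ (p , p<n , h≢0 , _) with fredholm n k (Elimination.H′ n k H e p p<n) (Elimination.e′ n k H e p p<n)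
  ...   | inj₁ sol = inj₁ (Elimination.lift-solution n k H e p p<n h≢0 sol)
  ...   | inj₂ obs = inj₂ (Elimination.lift-obstruction n k H e p p<n obs)
  fredholm n (suc k) H e | inj₁ column≡0 with fredholm n k H e
  ... | inj₁ (α , r , r≢0 , sol) = inj₁ (α , r , r≢0 , λ i i<n →
          trans (cong (λ x → ∑ k (λ j → H i j * α j) + x) (trans (cong (_* α k) (column≡0 i i<n)) (*-zeroˡ (α k))))
                (trans (+-identityʳ _) (sol i i<n)))
  ... | inj₂ (β , kills , ≢0) = inj₂ (β , kills-all , ≢0)
    where
    kills-all : ∀ j → j ℕ.< suc k → ∑ n (λ i → β i * H i j) ≡ 0ℤ
    kills-all j j<1+k with ℕ.m≤n⇒m<n∨m≡n (ℕ.s≤s⁻¹ j<1+k)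
    ... | inj₁ j<k  = kills j j<k
    ... | inj₂ refl = ∑-zero n λ i i<n → trans (cong (β i *_) (column≡0 i i<n)) (*-zeroʳ (β i))

  -- Recurrences with arbitrary leading coefficient, and divisibility along them.

  Rec : ℕ → (ℕ → ℤ) → (ℕ → ℤ) → Set
  Rec d f u = ∀ i → ∑ (suc d) (λ j → f j * u (i ℕ.+ j)) ≡ 0ℤ

  *-zero-cancelʳ : ∀ a {c} → c ≢ 0ℤ → a * c ≡ 0ℤ → a ≡ 0ℤ
  *-zero-cancelʳ a c≢0 ac≡0 with i*j≡0⇒i≡0∨j≡0 a ac≡0
  ... | inj₁ a≡0 = a≡0
  ... | inj₂ c≡0 = contradiction c≡0 c≢0

  ∣0 : ∀ {q x} → x ≡ 0ℤ → q ∣ x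
  ∣0 refl = divides 0ℤ refl

  ∑-head : ∀ n (f : ℕ → ℤ) → ∑ (suc n) f ≡ f 0 + ∑ n (f ∘ suc)
  ∑-head zero    f = trans (+-identityˡ (f 0)) (sym (+-identityʳ (f 0)))
  ∑-head (suc n) f = trans (cong (λ x → x + f (suc n)) (∑-head n f)) (+-assoc (f 0) (∑ n (f ∘ suc)) (f (suc n)))

  Rec-unscale : ∀ {d f V} V′ c → c ≢ 0ℤ → (∀ n → V n ≡ V′ n * c) → Rec d f V → Rec d f V′
  Rec-unscale {d} {f} {V} V′ c c≢0 V≡V′c rec i = *-zero-cancelʳ _ c≢0 (begin
    ∑ (suc d) (λ j → f j * V′ (i ℕ.+ j)) * c  ≡⟨ *-distribʳ-∑ (suc d) c _ ⟩
    ∑ (suc d) (λ j → f j * V′ (i ℕ.+ j) * c)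
      ≡⟨ ∑-cong (suc d) (λ j _ → trans (*-assoc (f j) (V′ (i ℕ.+ j)) c) (cong (f j *_) (sym (V≡V′c (i ℕ.+ j))))) ⟩
    ∑ (suc d) (λ j → f j * V (i ℕ.+ j))       ≡⟨ rec i ⟩
    0ℤ ∎)
    where open ≡-Reasoning

  Rec-unscale-coeffs : ∀ {d f V} f′ c → c ≢ 0ℤ → (∀ j → j ℕ.< suc d → f j ≡ f′ j * c) → Rec d f V → Rec d f′ V
  Rec-unscale-coeffs {d} {f} {V} f′ c c≢0 f≡f′c rec i = *-zero-cancelʳ _ c≢0 (begin
    ∑ (suc d) (λ j → f′ j * V (i ℕ.+ j)) * c  ≡⟨ *-distribʳ-∑ (suc d) c _ ⟩
    ∑ (suc d) (λ j → f′ j * V (i ℕ.+ j) * c)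
      ≡⟨ ∑-cong (suc d) (λ j j≤d → trans (move (f′ j) (V (i ℕ.+ j)) c) (cong (_* V (i ℕ.+ j)) (sym (f≡f′c j j≤d)))) ⟩
    ∑ (suc d) (λ j → f j * V (i ℕ.+ j))       ≡⟨ rec i ⟩
    0ℤ ∎)
    where
    open ≡-Reasoning
    move : ∀ x y z → x * y * z ≡ x * z * y
    move = solve-∀

  Rec-convolve : ∀ {d f u} k (α : ℕ → ℤ) → Rec d f u → Rec d f (λ i → ∑ k (λ j → α j * u (i ℕ.+ j)))
  Rec-convolve {d} {f} {u} k α rec i = begin
    ∑ (suc d) (λ l → f l * ∑ k (λ j → α j * u (i ℕ.+ l ℕ.+ j)))
      ≡⟨ ∑-cong (suc d) (λ l _ → *-distribˡ-∑ k (f l) _) ⟩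
    ∑ (suc d) (λ l → ∑ k (λ j → f l * (α j * u (i ℕ.+ l ℕ.+ j))))
      ≡⟨ ∑-swap (suc d) k _ ⟩
    ∑ k (λ j → ∑ (suc d) (λ l → f l * (α j * u (i ℕ.+ l ℕ.+ j))))
      ≡⟨ ∑-cong k (λ j _ → ∑-cong (suc d) (λ l _ →
           trans (swap (f l) (α j) _) (cong (λ n → α j * (f l * u n)) (shift i l j)))) ⟩
    ∑ k (λ j → ∑ (suc d) (λ l → α j * (f l * u (i ℕ.+ j ℕ.+ l))))
      ≡⟨ ∑-zero k (λ j _ → trans (sym (*-distribˡ-∑ (suc d) (α j) _)) (trans (cong (α j *_) (rec (i ℕ.+ j))) (*-zeroʳ (α j)))) ⟩
    0ℤ ∎
    where
    open ≡-Reasoning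
    swap : ∀ x y z → x * (y * z) ≡ y * (x * z)
    swap = solve-∀
    shift : ∀ i l j → i ℕ.+ l ℕ.+ j ≡ i ℕ.+ j ℕ.+ l
    shift i l j = trans (ℕ.+-assoc i l j) (trans (cong (i ℕ.+_) (ℕ.+-comm l j)) (sym (ℕ.+-assoc i j l)))

  -- Satisfied by 0 and by the primes; at q = 0, divisibility by q means vanishing.
  Euclidean : ℤ → Set
  Euclidean q = ∀ a b → q ∣ a * b → (q ∣ a) ⊎ (q ∣ b)

  euclidean-0 : Euclidean 0ℤ
  euclidean-0 a b 0∣ab with i*j≡0⇒i≡0∨j≡0 a (0∣⇒≡0 0∣ab)
  ... | inj₁ a≡0 = inj₁ (∣0 a≡0)
  ... | inj₂ b≡0 = inj₂ (∣0 b≡0)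

  euclidean-prime : ∀ {p} → Prime p → Euclidean (+ p)
  euclidean-prime {p} p-prime a b p∣ab with euclidsLemma ∣ a ∣ ∣ b ∣ p-prime (subst (p ℕ∣.∣_) (abs-* a b) (∣⇒∣ᵤ p∣ab))
  ... | inj₁ p∣a = inj₁ (∣ᵤ⇒∣ p∣a)
  ... | inj₂ p∣b = inj₂ (∣ᵤ⇒∣ p∣b)

  module _ {q d f V} (euclidean : Euclidean q) (rec : Rec d f V)
           {m} (m≤d : m ℕ.≤ d) (q∤fm : ¬ q ∣ f m) where

    private
      -- In the recurrence at `n ∸ m`, the coefficient `f m` meets `V n`. All other terms being
      -- divisible by `q`, so is `f m * V n`, and `f m` can be cancelled.
      isolate : ∀ n → m ℕ.≤ n → (∀ j → j ℕ.< suc d → j ≢ m → (q ∣ f j) ⊎ (q ∣ V (n ℕ.∸ m ℕ.+ j))) → q ∣ V n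
      isolate n m≤n others with euclidean (f m) (V n) q∣fV
        where
        i = n ℕ.∸ m
        term : ∀ j → (q ∣ f j) ⊎ (q ∣ V (i ℕ.+ j)) → q ∣ f j * V (i ℕ.+ j)
        term j (inj₁ q∣f) = ∣m⇒∣m*n (V (i ℕ.+ j)) q∣f
        term j (inj₂ q∣V) = ∣n⇒∣m*n (f j) q∣V
        q∣fV : q ∣ f m * V n
        q∣fV = subst (λ x → q ∣ f m * V x) (ℕ.m∸n+n≡m m≤n)
          (∑-∣-isolate (suc d) {f = λ j → f j * V (i ℕ.+ j)} (s≤s m≤d) (λ j j≤d j≢m → term j (others j j≤d j≢m)) (∣0 (rec i)))
      ... | inj₁ q∣f = contradiction q∣f q∤fm
      ... | inj₂ q∣V = q∣V

    -- Modulo `q` the recurrence has leading coefficient `f m`, so each term is determined by its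
    -- `m` predecessors. At `q = 0` this propagates vanishing.
    ∣-upward : (∀ j → m ℕ.< j → j ℕ.< suc d → q ∣ f j) → (∀ i → i ℕ.< m → q ∣ V i) → ∀ n → q ∣ V n
    ∣-upward above initial = <-rec (λ n → q ∣ V n) step
      where
      step : ∀ n → (∀ {i} → i ℕ.< n → q ∣ V i) → q ∣ V n
      step n IH with n ℕ.<? m
      ... | yes n<m = initial n n<m
      ... | no n≮m = isolate n m≤n others
        where
        m≤n = ℕ.≮⇒≥ n≮m
        others : ∀ j → j ℕ.< suc d → j ≢ m → (q ∣ f j) ⊎ (q ∣ V (n ℕ.∸ m ℕ.+ j))
        others j j≤d j≢m with ℕ.<-cmp j m
        ... | tri< j<m _ _ = inj₂ (IH (subst (n ℕ.∸ m ℕ.+ j ℕ.<_) (ℕ.m∸n+n≡m m≤n) (ℕ.+-monoʳ-< (n ℕ.∸ m) j<m)))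
        ... | tri≈ _ j≡m _ = contradiction j≡m j≢m
        ... | tri> _ _ m<j = inj₁ (above j m<j j≤d)

    -- The mirror image: modulo `q` the lowest coefficient is `f m`, so a term is determined by its
    -- successors. The index must be at least `m` for the recurrence to reach it.
    ∣-downward : (∀ j → j ℕ.< m → q ∣ f j) → ∀ L → (∀ i → L ℕ.≤ i → q ∣ V i) → ∀ n → m ℕ.≤ n → q ∣ V n
    ∣-downward below L tail n m≤n = descend L n m≤n (ℕ.m≤n+m L n)
      where
      descend : ∀ t n → m ℕ.≤ n → L ℕ.≤ n ℕ.+ t → q ∣ V n
      descend zero    n m≤n L≤n+t = tail n (subst (L ℕ.≤_) (ℕ.+-identityʳ n) L≤n+t)
      descend (suc t) n m≤n L≤n+t = isolate n m≤n others
        where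
        others : ∀ j → j ℕ.< suc d → j ≢ m → (q ∣ f j) ⊎ (q ∣ V (n ℕ.∸ m ℕ.+ j))
        others j j≤d j≢m with ℕ.<-cmp j m
        ... | tri< j<m _ _ = inj₁ (below j j<m)
        ... | tri≈ _ j≡m _ = contradiction j≡m j≢m
        ... | tri> _ _ m<j = inj₂ (descend t (n ℕ.∸ m ℕ.+ j) (ℕ.≤-trans m≤n (ℕ.<⇒≤ n<))
                               (ℕ.≤-trans L≤n+t (subst (ℕ._≤ n ℕ.∸ m ℕ.+ j ℕ.+ t) (sym (ℕ.+-suc n t)) (ℕ.+-monoˡ-≤ t n<))))
          where
          n< : n ℕ.< n ℕ.∸ m ℕ.+ j
          n< = subst (ℕ._< n ℕ.∸ m ℕ.+ j) (ℕ.m∸n+n≡m m≤n) (ℕ.+-monoʳ-< (n ℕ.∸ m) m<j)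

  -- Fatou's lemma: from arbitrary to monic recurrences.

  prime≢0 : ∀ {p} → Prime p → + p ≢ 0ℤ
  prime≢0 p-prime p≡0 = ℕ.≢-nonZero⁻¹ _ {{prime⇒nonZero p-prime}} (+-injective p≡0)

  ∣quotient∣< : ∀ {p x} y → Prime p → x ≡ y * + p → x ≢ 0ℤ → ∣ y ∣ ℕ.< ∣ x ∣
  ∣quotient∣< {p} {x} y p-prime refl x≢0 =
    subst (∣ y ∣ ℕ.<_) (sym (abs-* y (+ p))) (ℕ.m<m*n ∣ y ∣ p {{ℕ.≢-nonZero ∣y∣≢0}} (ℕ.nonTrivial⇒n>1 p {{prime⇒nonTrivial p-prime}}))
    where
    ∣y∣≢0 : ∣ y ∣ ≢ 0
    ∣y∣≢0 ∣y∣≡0 = x≢0 (cong (_* + p) (∣i∣≡0⇒i≡0 {y} ∣y∣≡0))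

  -- Otherwise p would divide all of V, hence V d infinitely often.
  unit-leading-coeff : ∀ {p d f} V → Prime p → Rec (suc d) f V → + p ∣ f (suc d) →
    (∀ i → i ℕ.< d → V i ≡ 0ℤ) → V d ≢ 0ℤ → ∀ j → j ℕ.< suc (suc d) → + p ∣ f j
  unit-leading-coeff {p} {d} {f} V p-prime rec p∣top V≡0 Vd≢0 with lastCounterexample (λ j → + p ∣? f j) (suc (suc d))
  ... | inj₁ all = all
  ... | inj₂ (m , m≤1+d , p∤fm , above) = ⊥-elim (descent _ V refl rec V≡0 Vd≢0)
    where
    -- Here `m` is the last index whose coefficient `p` does not divide. As `p` divides the top one,
    -- `m ≤ d`, so the initial values needed for `∣-upward` are among the zeros of `V`.
    m≤d : m ℕ.≤ d
    m≤d with ℕ.m≤n⇒m<n∨m≡n (ℕ.s≤s⁻¹ m≤1+d)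
    ... | inj₁ m<1+d = ℕ.s≤s⁻¹ m<1+d
    ... | inj₂ refl  = contradiction p∣top p∤fm

    Impossible : ℕ → Set
    Impossible s = ∀ V → ∣ V d ∣ ≡ s → Rec (suc d) f V → (∀ i → i ℕ.< d → V i ≡ 0ℤ) → V d ≢ 0ℤ → ⊥

    step : ∀ s → (∀ {s′} → s′ ℕ.< s → Impossible s′) → Impossible s
    step _ IH V refl rec V≡0 Vd≢0 =
      IH (∣quotient∣< (V′ d) p-prime (V≡V′p d) Vd≢0) V′ refl (Rec-unscale {suc d} {f} {V} V′ (+ p) (prime≢0 p-prime) V≡V′p rec)
        (λ i i<d → *-zero-cancelʳ (V′ i) (prime≢0 p-prime) (trans (sym (V≡V′p i)) (V≡0 i i<d)))
        (λ V′d≡0 → Vd≢0 (trans (V≡V′p d) (cong (_* + p) V′d≡0)))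
      where
      p∣V : ∀ n → + p ∣ V n
      p∣V = ∣-upward {d = suc d} {f} {V} (euclidean-prime p-prime) rec (ℕ.m≤n⇒m≤1+n m≤d) p∤fm above
              (λ i i<m → ∣0 (V≡0 i (ℕ.<-≤-trans i<m m≤d)))
      V′ : ℕ → ℤ
      V′ n = quotient (p∣V n)
      V≡V′p : ∀ n → V n ≡ V′ n * + p
      V≡V′p n = _∣_.equality (p∣V n)

    descent : ∀ s → Impossible s
    descent = <-rec Impossible step

  Monic : ℕ → (ℕ → ℤ) → Set
  Monic d u = ∃ λ f → f d ≡ 1ℤ × Rec d f u

  -- Descent on the absolute value of the leading coefficient: a prime dividing it divides all
  -- coefficients by `unit-leading-coeff` and is cancelled from the recurrences of `u` and `V` at
  -- once. At the end the leading coefficient is a unit, and multiplying by it makes it 1.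
  monic-from-impulse : ∀ {d f u} V → Rec (suc d) f V → (∀ i → i ℕ.< d → V i ≡ 0ℤ) → V d ≢ 0ℤ →
    f (suc d) ≢ 0ℤ → Rec (suc d) f u → Monic (suc d) u
  monic-from-impulse {d} {f} {u} V recV V≡0 Vd≢0 = λ top≢0 → <-rec Claim step _ f refl top≢0 recV
    where
    Claim : ℕ → Set
    Claim s = ∀ f → ∣ f (suc d) ∣ ≡ s → f (suc d) ≢ 0ℤ → Rec (suc d) f V → Rec (suc d) f u → Monic (suc d) u

    ∣x∣≡1⇒x*x≡1 : ∀ x → ∣ x ∣ ≡ 1 → x * x ≡ 1ℤ
    ∣x∣≡1⇒x*x≡1 (+ 1)    refl = refl
    ∣x∣≡1⇒x*x≡1 -[1+ 0 ] refl = refl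

    step : ∀ s → (∀ {s′} → s′ ℕ.< s → Claim s′) → Claim s
    step _ IH f refl top≢0 recV recu with ∣ f (suc d) ∣ ℕ.≟ 1
    ... | yes ∣top∣≡1 = (λ j → top * f j) , ∣x∣≡1⇒x*x≡1 top ∣top∣≡1 , λ i →
            trans (∑-cong (suc (suc d)) (λ j _ → *-assoc top (f j) (u (i ℕ.+ j))))
            (trans (sym (*-distribˡ-∑ (suc (suc d)) top _))
            (trans (cong (top *_) (recu i)) (*-zeroʳ top)))
      where top = f (suc d)
    ... | no ∣top∣≢1 with primeDivisor ∣ f (suc d) ∣ (ℕ.≤∧≢⇒< (ℕ.n≢0⇒n>0 (top≢0 ∘ ∣i∣≡0⇒i≡0)) (∣top∣≢1 ∘ sym))
    ...   | p , p-prime , p∣top = IH (∣quotient∣< (f′ (suc d)) p-prime (f≡f′p (suc d) ℕ.≤-refl) top≢0) f′ refl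
              (λ f′≡0 → top≢0 (trans (f≡f′p (suc d) ℕ.≤-refl) (cong (_* + p) f′≡0)))
              (Rec-unscale-coeffs {suc d} {f} {V} f′ (+ p) (prime≢0 p-prime) f≡f′p recV)
              (Rec-unscale-coeffs {suc d} {f} {u} f′ (+ p) (prime≢0 p-prime) f≡f′p recu)
      where
      p∣f : ∀ j → j ℕ.< suc (suc d) → + p ∣ f j
      p∣f = unit-leading-coeff {d = d} {f} V p-prime recV (∣ᵤ⇒∣ p∣top) V≡0 Vd≢0
      f′ : ℕ → ℤ
      f′ j with + p ∣? f j
      ... | yes p∣fj = quotient p∣fj
      -- Only indices beyond the order can end here; 0 is a placeholder.
      ... | no  _    = 0ℤ
      f≡f′p : ∀ j → j ℕ.< suc (suc d) → f j ≡ f′ j * + p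
      f≡f′p j j≤d with + p ∣? f j
      ... | yes (divides _ eq) = eq
      ... | no p∤fj = contradiction (p∣f j j≤d) p∤fj

  -- The shifts of u combine to a nonzero multiple of the impulse response of the recurrence.
  Impulse : ℕ → (ℕ → ℤ) → Set
  Impulse d u = ∃ λ (α : ℕ → ℤ) → (∀ i → i ℕ.< d → ∑ (suc d) (λ j → α j * u (i ℕ.+ j)) ≡ 0ℤ)
                                × ∑ (suc d) (λ j → α j * u (d ℕ.+ j)) ≢ 0ℤ

  -- The Fredholm alternative for the Hankel matrix of `u` and the last unit vector. An obstruction
  -- `β` annihilates the first `suc d` shifts, hence all of them by the recurrence, and its pairing
  -- with the unit vector is `β d`: it is a recurrence of order one less.
  impulse-or-shorter : ∀ {d f u} → f (suc d) ≢ 0ℤ → Rec (suc d) f u →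
    Impulse d u ⊎ (∃ λ β → β d ≢ 0ℤ × Rec d β u)
  impulse-or-shorter {d} {f} {u} top≢0 rec with fredholm (suc d) (suc d) (λ i j → u (i ℕ.+ j)) (unit d)
  ... | inj₁ (α , r , r≢0 , sol) = inj₁ (α , zeros , nonzero)
    where
    value : ∀ i → i ℕ.< suc d → ∑ (suc d) (λ j → α j * u (i ℕ.+ j)) ≡ r * unit d i
    value i i≤d = trans (∑-cong (suc d) (λ j _ → *-comm (α j) (u (i ℕ.+ j)))) (sol i i≤d)
    zeros : ∀ i → i ℕ.< d → _
    zeros i i<d = trans (value i (ℕ.m<n⇒m<1+n i<d)) (trans (cong (r *_) (unit-off d i (ℕ.<⇒≢ i<d))) (*-zeroʳ r))
    nonzero : ∑ (suc d) (λ j → α j * u (d ℕ.+ j)) ≢ 0ℤ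
    nonzero ≡0 = r≢0 (trans (sym (*-identityʳ r)) (trans (cong (r *_) (sym (unit-diag d))) (trans (sym (value d ℕ.≤-refl)) ≡0)))
  ... | inj₂ (β , kills , pairing≢0) = inj₂ (β , βd≢0 , λ i → 0∣⇒≡0 (vanishes i))
    where
    βd≢0 : β d ≢ 0ℤ
    βd≢0 βd≡0 = pairing≢0 (trans (∑-cong (suc d) (λ i _ → *-comm (β i) (unit d i))) (trans (∑-unit (suc d) d β ℕ.≤-refl) βd≡0))
    vanishes : ∀ i → 0ℤ ∣ ∑ (suc d) (λ j → β j * u (i ℕ.+ j))
    vanishes = ∣-upward {d = suc d} {f} {λ i → ∑ (suc d) (λ j → β j * u (i ℕ.+ j))} euclidean-0 (Rec-convolve {suc d} {f} {u} (suc d) β rec) ℕ.≤-refl (top≢0 ∘ 0∣⇒≡0)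
      (λ j d<j j≤d → contradiction d<j (ℕ.≤⇒≯ (ℕ.s≤s⁻¹ j≤d)))
      (λ i i≤d → ∣0 (trans (∑-cong (suc d) (λ j _ → cong (λ n → β j * u n) (ℕ.+-comm i j))) (kills i i≤d)))

  -- Fatou's lemma.
  monic-recurrence : ∀ d f u → (∀ i → u i ≢ 0ℤ) → f d ≢ 0ℤ → Rec d f u → ∃ λ e → e ℕ.≤ d × Monic e u
  monic-recurrence zero f u u≢0 top≢0 rec = contradiction (trans (sym (+-identityˡ _)) (rec 0)) (*-nonzero top≢0 (u≢0 0))
  monic-recurrence (suc d) f u u≢0 top≢0 rec with impulse-or-shorter {d} {f} {u} top≢0 rec
  ... | inj₁ (α , zeros , nonzero) =
    suc d , ℕ.≤-refl , monic-from-impulse {d} {f} {u} _ (Rec-convolve {suc d} {f} {u} (suc d) α rec) zeros nonzero top≢0 rec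
  ... | inj₂ (β , βd≢0 , rec′) with monic-recurrence d β u u≢0 βd≢0 rec′
  ...   | e , e≤d , monic = e , ℕ.m≤n⇒m≤1+n e≤d , monic

  -- `k-min` asks for a nonzero lowest coefficient. A zero one is dropped by shifting the sequence;
  -- the order cannot sink to 0, since `u` has no zero terms.
  strip-zeros : ∀ d g u → (∀ i → u i ≢ 0ℤ) → g d ≡ 1ℤ → Rec d g u →
    ∃ λ m → ∃ λ s → ∃ λ h → m ℕ.< d × h 0 ≢ 0ℤ × h (suc m) ≡ 1ℤ × Rec (suc m) h (λ i → u (s ℕ.+ i))
  strip-zeros zero g u u≢0 g0≡1 rec =
    contradiction (trans (sym (+-identityˡ _)) (rec 0)) (*-nonzero (λ g0≡0 → contradiction (trans (sym g0≡1) g0≡0) λ ()) (u≢0 0))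
  strip-zeros (suc d) g u u≢0 top≡1 rec with g 0 ≟ 0ℤ
  ... | no  g0≢0 = d , 0 , g , ℕ.≤-refl , g0≢0 , top≡1 , rec
  ... | yes g0≡0 with strip-zeros d (g ∘ suc) (u ∘ suc) (u≢0 ∘ suc) top≡1 rec′
    where
    rec′ : Rec d (g ∘ suc) (u ∘ suc)
    rec′ i = begin
      ∑ (suc d) (λ j → g (suc j) * u (suc (i ℕ.+ j)))
        ≡⟨ ∑-cong (suc d) (λ j _ → cong (λ n → g (suc j) * u n) (sym (ℕ.+-suc i j))) ⟩
      ∑ (suc d) (λ j → g (suc j) * u (i ℕ.+ suc j))
        ≡⟨ sym (+-identityˡ _) ⟩
      0ℤ + ∑ (suc d) (λ j → g (suc j) * u (i ℕ.+ suc j))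
        ≡⟨ cong (λ x → x * u (i ℕ.+ 0) + ∑ (suc d) (λ j → g (suc j) * u (i ℕ.+ suc j))) (sym g0≡0) ⟩
      g 0 * u (i ℕ.+ 0) + ∑ (suc d) (λ j → g (suc j) * u (i ℕ.+ suc j))
        ≡⟨ sym (∑-head (suc d) (λ j → g j * u (i ℕ.+ j))) ⟩
      ∑ (suc (suc d)) (λ j → g j * u (i ℕ.+ j))
        ≡⟨ rec i ⟩
      0ℤ ∎
      where open ≡-Reasoning
  ...   | m , s , h , m<d , h0≢0 , top≡1′ , rec″ = m , suc s , h , ℕ.m<n⇒m<1+n m<d , h0≢0 , top≡1′ , rec″

  -- A prime p dividing V eventually divides V d already (backward induction), and can be cancelled from g and V.
  eventual-divisor-of-impulse : ∀ {d f} → (∀ p → Prime p → ∃ λ j → j ℕ.≤ d × ¬ + p ∣ f j) →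
    ∀ g V → 0 ℕ.< g → Rec (suc d) f V → (∀ i → i ℕ.< d → V i ≡ 0ℤ) →
    ∀ L → (∀ i → L ℕ.≤ i → + g ∣ V i) → + g ∣ V d
  eventual-divisor-of-impulse {d} {f} coprime = <-rec Claim step
    where
    Claim : ℕ → Set
    Claim g = ∀ V → 0 ℕ.< g → Rec (suc d) f V → (∀ i → i ℕ.< d → V i ≡ 0ℤ) →
              ∀ L → (∀ i → L ℕ.≤ i → + g ∣ V i) → + g ∣ V d

    step : ∀ g → (∀ {g′} → g′ ℕ.< g → Claim g′) → Claim g
    step g IH V 0<g rec V≡0 L tail with g ℕ.≟ 1
    ... | yes refl = divides (V d) (sym (*-identityʳ (V d)))
    ... | no g≢1 with primeDivisor g (ℕ.≤∧≢⇒< 0<g (g≢1 ∘ sym))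
    ...   | p , p-prime , ℕ∣.divides g′ refl with firstCounterexample (λ j → + p ∣? f j) (suc d)
    ...     | inj₁ all = let j , j≤d , p∤fj = coprime p p-prime in contradiction (all j (s≤s j≤d)) p∤fj
    ...     | inj₂ (m , m≤d , p∤fm , below) = subst (+ (g′ ℕ.* p) ∣_) (sym (V≡V′p d)) (scale (IH g′<g V′ 0<g′
                (Rec-unscale {suc d} {f} {V} V′ (+ p) (prime≢0 p-prime) V≡V′p rec)
                (λ i i<d → *-zero-cancelʳ (V′ i) (prime≢0 p-prime) (trans (sym (V≡V′p i)) (V≡0 i i<d)))
                L (λ i L≤i → unscale (subst (+ (g′ ℕ.* p) ∣_) (V≡V′p i) (tail i L≤i)))))
      where
      0<g′ : 0 ℕ.< g′
      0<g′ = ℕ.n≢0⇒n>0 λ { refl → ℕ.n≮n 0 0<g }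
      g′<g : g′ ℕ.< g′ ℕ.* p
      g′<g = ℕ.m<m*n g′ p {{ℕ.>-nonZero 0<g′}} (ℕ.nonTrivial⇒n>1 p {{prime⇒nonTrivial p-prime}})
      p∣tail : ∀ i → L ℕ.≤ i → + p ∣ V i
      p∣tail i L≤i = ∣-trans (divides (+ g′) (pos-* g′ p)) (tail i L≤i)
      -- Backward induction reaches the indices from `m` on, where `m ≤ d` is the first index whose
      -- coefficient `p` does not divide; below `d` the sequence is zero.
      p∣V : ∀ n → + p ∣ V n
      p∣V n with n ℕ.<? d
      ... | yes n<d = ∣0 (V≡0 n n<d)
      ... | no n≮d = ∣-downward {d = suc d} {f} {V} (euclidean-prime p-prime) rec (ℕ.<⇒≤ m≤d) p∤fm below L p∣tail n
                       (ℕ.≤-trans (ℕ.s≤s⁻¹ m≤d) (ℕ.≮⇒≥ n≮d))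
      V′ : ℕ → ℤ
      V′ n = quotient (p∣V n)
      V≡V′p : ∀ n → V n ≡ V′ n * + p
      V≡V′p n = _∣_.equality (p∣V n)
      scale : ∀ {x} → + g′ ∣ x → + (g′ ℕ.* p) ∣ x * + p
      scale (divides k refl) = divides k (trans (*-assoc k (+ g′) (+ p)) (cong (k *_) (sym (pos-* g′ p))))
      unscale : ∀ {x} → + (g′ ℕ.* p) ∣ x * + p → + g′ ∣ x
      unscale {x} (divides k eq) = divides k (*-cancelʳ-≡ x (k * + g′) (+ p) {{≢-nonZero (prime≢0 p-prime)}}
        (trans eq (trans (cong (k *_) (pos-* g′ p)) (sym (*-assoc k (+ g′) (+ p))))))

  -- The recurrence of the numeration system and its eventual common divisors.

  -- The characteristic polynomial of the recurrence, lowest coefficient at index 0 and leading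
  -- coefficient 1 at index `n`.
  coeff : ∀ n → (Fin n → ℤ) → ℕ → ℤ
  coeff zero    a _       = 1ℤ
  coeff (suc n) a zero    = - a fzero
  coeff (suc n) a (suc j) = coeff n (a ∘ fsuc) j

  coeff-top : ∀ n a → coeff n a n ≡ 1ℤ
  coeff-top zero    a = refl
  coeff-top (suc n) a = coeff-top n (a ∘ fsuc)

  coeff-toℕ : ∀ n a (j : Fin n) → coeff n a (toℕ j) ≡ - a j
  coeff-toℕ (suc n) a fzero    = refl
  coeff-toℕ (suc n) a (fsuc j) = coeff-toℕ n (a ∘ fsuc) j

  ∑-sumFinℤ : ∀ n (h : ℕ → ℤ) (a : Fin n → ℤ) (v : ℕ → ℤ) → (∀ j → h (toℕ j) ≡ - a j) →
    ∑ n (λ j → h j * v j) ≡ - sumFinℤ n (λ j → a j * v (toℕ j))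
  ∑-sumFinℤ zero    h a v h≡-a = refl
  ∑-sumFinℤ (suc n) h a v h≡-a = begin
    ∑ (suc n) (λ j → h j * v j)                     ≡⟨ ∑-head n _ ⟩
    h 0 * v 0 + ∑ n (λ j → h (suc j) * v (suc j))
      ≡⟨ cong₂ (λ x y → x * v 0 + y) (h≡-a fzero) (∑-sumFinℤ n (h ∘ suc) (a ∘ fsuc) (v ∘ suc) (h≡-a ∘ fsuc)) ⟩
    - a fzero * v 0 + - rest                        ≡⟨ negate (a fzero) (v 0) rest ⟩
    - (a fzero * v 0 + rest) ∎
    where
    open ≡-Reasoning
    rest = sumFinℤ n (λ j → a (fsuc j) * v (suc (toℕ j)))
    negate : ∀ x y z → - x * y + - z ≡ - (x * y + z)
    negate = solve-∀

  ∣-gcdFin : ∀ {p} n (a : Fin n → ℤ) → (∀ j → + p ∣ a j) → p ℕ∣.∣ gcdFin n a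
  ∣-gcdFin zero    a p∣a = ℕ∣._∣0 _
  ∣-gcdFin (suc n) a p∣a = gcd-greatest (∣⇒∣ᵤ (p∣a fzero)) (∣-gcdFin n (a ∘ fsuc) (p∣a ∘ fsuc))

  all-∣-or-some-∤ : ∀ {p} n (a : Fin n → ℤ) → (∀ j → + p ∣ a j) ⊎ (∃ λ j → ¬ + p ∣ a j)
  all-∣-or-some-∤ zero a = inj₁ λ ()
  all-∣-or-some-∤ {p} (suc n) a with + p ∣? a fzero | all-∣-or-some-∤ n (a ∘ fsuc)
  ... | no  p∤a₀ | _                 = inj₂ (fzero , p∤a₀)
  ... | yes _    | inj₂ (j , p∤aj)   = inj₂ (fsuc j , p∤aj)
  ... | yes p∣a₀ | inj₁ all          = inj₁ λ { fzero → p∣a₀ ; (fsuc j) → all j }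

  module _ (S : LinearNumerationSystem) where
    private
      k = suc (m S)
      u : ℕ → ℤ
      u i = + U S (N S ℕ.+ i)
      f = coeff k (a S)

      u≢0 : ∀ i → u i ≢ 0ℤ
      u≢0 i u≡0 = ℕ.<⇒≢ (U-positive S (N S ℕ.+ i)) (sym (+-injective u≡0))

      top≢0 : f k ≢ 0ℤ
      top≢0 top≡0 = contradiction (trans (sym (coeff-top k (a S))) top≡0) λ ()

      u-rec : Rec k f u
      u-rec i = begin
        ∑ k (λ j → f j * u (i ℕ.+ j)) + f k * u (i ℕ.+ k)
          ≡⟨ cong₂ _+_ (∑-sumFinℤ k f (a S) (λ j → u (i ℕ.+ j)) (coeff-toℕ k (a S)))
                       (trans (cong (_* u (i ℕ.+ k)) (coeff-top k (a S))) (*-identityˡ (u (i ℕ.+ k)))) ⟩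
        - sumFinℤ k (λ j → a S j * u (i ℕ.+ toℕ j)) + u (i ℕ.+ k)
          ≡⟨ cong (λ x → - x + u (i ℕ.+ k)) (sym u-step) ⟩
        - u (i ℕ.+ k) + u (i ℕ.+ k)
          ≡⟨ +-inverseˡ (u (i ℕ.+ k)) ⟩
        0ℤ ∎
        where
        open ≡-Reasoning
        sum-assoc : ∀ n (b : Fin n → ℤ) (c : Fin n → ℕ) →
          sumFinℤ n (λ j → b j * + U S (N S ℕ.+ i ℕ.+ c j)) ≡ sumFinℤ n (λ j → b j * + U S (N S ℕ.+ (i ℕ.+ c j)))
        sum-assoc zero    b c = refl
        sum-assoc (suc n) b c =
          cong₂ (λ x y → b fzero * + U S x + y) (ℕ.+-assoc (N S) i (c fzero)) (sum-assoc n (b ∘ fsuc) (c ∘ fsuc))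
        u-step : u (i ℕ.+ k) ≡ sumFinℤ k (λ j → a S j * u (i ℕ.+ toℕ j))
        u-step = trans (cong (λ n → + U S n) (sym (ℕ.+-assoc (N S) i k)))
                       (trans (rec S (N S ℕ.+ i) (ℕ.m≤m+n (N S) i)) (sum-assoc k (a S) toℕ))

      -- `k-min` does not apply to `β` directly, whose leading coefficient is any nonzero integer
      -- and whose lowest one may vanish. `monic-recurrence` and `strip-zeros` repair these two
      -- defects without raising the order.
      no-shorter : ∀ β → β (m S) ≢ 0ℤ → ¬ Rec (m S) β u
      no-shorter β βm≢0 β-rec with monic-recurrence (m S) β u u≢0 βm≢0 β-rec
      ... | e , e≤m , g , g-top , g-rec with strip-zeros e g u u≢0 g-top g-rec
      ...   | m′ , s , h , m′<e , h0≢0 , h-top , h-rec =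
        ℕ.<⇒≱ (ℕ.<-≤-trans m′<e e≤m) (k-min S m′ a′ (N S ℕ.+ s) a′0≢0 recurrence)
        where
        a′ : Fin (suc m′) → ℤ
        a′ j = - h (toℕ j)
        a′0≢0 : a′ fzero ≢ 0ℤ
        a′0≢0 -h0≡0 = h0≢0 (trans (sym (neg-involutive (h 0))) (cong -_ -h0≡0))
        recurrence : Recurrence (U S) m′ a′ (N S ℕ.+ s)
        recurrence i N+s≤i with ℕ.m≤n⇒∃[o]m+o≡n N+s≤i
        ... | o , refl = begin
          v (suc m′)                     ≡⟨ sym (*-identityˡ _) ⟩
          1ℤ * v (suc m′)                ≡⟨ cong (_* v (suc m′)) (sym h-top) ⟩
          h (suc m′) * v (suc m′)        ≡⟨ solve-sum (∑ (suc m′) (λ j → h j * v j)) (h (suc m′) * v (suc m′)) h-rec′ ⟩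
          - ∑ (suc m′) (λ j → h j * v j)
            ≡⟨ cong -_ (∑-sumFinℤ (suc m′) h a′ v (λ j → sym (neg-involutive (h (toℕ j))))) ⟩
          - - sumFinℤ (suc m′) (λ j → a′ j * v (toℕ j)) ≡⟨ neg-involutive _ ⟩
          sumFinℤ (suc m′) (λ j → a′ j * v (toℕ j)) ∎
          where
          open ≡-Reasoning
          v : ℕ → ℤ
          v j = + U S (N S ℕ.+ s ℕ.+ o ℕ.+ j)
          solve-sum : ∀ x y → x + y ≡ 0ℤ → y ≡ - x
          solve-sum x y x+y≡0 = trans (rearrange x y) (trans (cong (λ z → z + - x) x+y≡0) (+-identityˡ (- x)))
            where
            rearrange : ∀ x y → y ≡ (x + y) + - x
            rearrange = solve-∀
          index : ∀ j → N S ℕ.+ s ℕ.+ o ℕ.+ j ≡ N S ℕ.+ (s ℕ.+ (o ℕ.+ j))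
          index j = trans (ℕ.+-assoc (N S ℕ.+ s) o j) (ℕ.+-assoc (N S) s (o ℕ.+ j))
          h-rec′ : ∑ (suc (suc m′)) (λ j → h j * v j) ≡ 0ℤ
          h-rec′ = trans (∑-cong (suc (suc m′)) (λ j _ → cong (λ n → h j * + U S n) (index j))) (h-rec o)

      coprime : gcdFin k (a S) ≡ 1 → ∀ p → Prime p → ∃ λ j → j ℕ.≤ m S × ¬ + p ∣ f j
      coprime gcd≡1 p p-prime with all-∣-or-some-∤ {p} k (a S)
      ... | inj₁ all = contradiction (ℕ∣.∣1⇒≡1 (subst (p ℕ∣.∣_) gcd≡1 (∣-gcdFin k (a S) all)))
                                     (λ { refl → ℕ.n≮n 1 (ℕ.nonTrivial⇒n>1 1 {{prime⇒nonTrivial p-prime}}) })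
      ... | inj₂ (j , p∤aj) = toℕ j , ℕ.s≤s⁻¹ (toℕ<n j) , λ p∣f →
              p∤aj (subst (+ p ∣_) (neg-involutive (a S j)) (∣m⇒∣-m (subst (+ p ∣_) (coeff-toℕ k (a S) j) p∣f)))

    eventual-divisors-bounded : gcdFin k (a S) ≡ 1 →
      ∃ λ R → ∀ g L → 0 ℕ.< g → (∀ i → L ℕ.≤ i → g ℕ∣.∣ U S i) → g ℕ.≤ R
    eventual-divisors-bounded gcd≡1 with impulse-or-shorter {m S} {f} {u} top≢0 u-rec
    ... | inj₂ (β , βm≢0 , β-rec) = contradiction β-rec (no-shorter β βm≢0)
    ... | inj₁ (α , zeros , nonzero) = ∣ r ∣ , λ g L 0<g g∣U →
      ℕ∣.∣⇒≤ {{ℕ.≢-nonZero (nonzero ∘ ∣i∣≡0⇒i≡0)}} (∣⇒∣ᵤ (eventual-divisor-of-impulse {m S} {f} (coprime gcd≡1) g V 0<g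
        (Rec-convolve {k} {f} {u} k α u-rec) zeros L (λ i L≤i → ∑-∣ k (λ j _ → ∣n⇒∣m*n (α j)
          (∣ᵤ⇒∣ (g∣U (N S ℕ.+ (i ℕ.+ j)) (ℕ.≤-trans L≤i (ℕ.≤-trans (ℕ.m≤m+n i j) (ℕ.m≤n+m (i ℕ.+ j) (N S))))))))))
      where
      V : ℕ → ℤ
      V i = ∑ k (λ j → α j * u (i ℕ.+ j))
      r = V (m S)

open import Data.Nat
open import Data.Nat.Properties
open import Data.Nat.DivMod hiding (result)
open import Data.Nat.Divisibility
open import Data.Nat.Tactic.RingSolver using (solve-∀)
import Data.Integer as ℤ
import Data.Integer.Properties as ℤ
import Data.Integer.Divisibility.Signed as ℤ∣
import Data.Integer.Tactic.RingSolver as ℤSolver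

-- Greedy representations, most significant digit first.

module Greediness (S : LinearNumerationSystem) where

  private
    V = U S

  i<U : ∀ i → i < V i
  i<U zero    = U-positive S 0
  i<U (suc i) = ≤-<-trans (i<U i) (U-incr S i)

  U-mono : ∀ {i j} → i ≤ j → V i ≤ V j
  U-mono {i} {j} i≤j = go (≤⇒≤′ i≤j)
    where
    go : ∀ {j} → i ≤′ j → V i ≤ V j
    go ≤′-refl           = ≤-refl
    go {suc j} (≤′-step i≤′j) = ≤-trans (go i≤′j) (<⇒≤ (U-incr S j))

  -- The value of a word placed in front of ℓ further digits.
  valueAt : ℕ → Word S → ℕ
  valueAt ℓ []      = 0
  valueAt ℓ (d ∷ w) = toℕ d * V (ℓ + length w) + valueAt ℓ w

  value : Word S → ℕ
  value = valueAt 0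

  valueAt-++ : ∀ ℓ x w → valueAt ℓ (x ++ w) ≡ valueAt (ℓ + length w) x + valueAt ℓ w
  valueAt-++ ℓ []      w = refl
  valueAt-++ ℓ (d ∷ x) w = begin
    toℕ d * V (ℓ + length (x ++ w)) + valueAt ℓ (x ++ w)
      ≡⟨ cong₂ (λ n v → toℕ d * V n + v) position (valueAt-++ ℓ x w) ⟩
    toℕ d * V (ℓ + length w + length x) + (valueAt (ℓ + length w) x + valueAt ℓ w)
      ≡⟨ sym (+-assoc (toℕ d * V (ℓ + length w + length x)) _ _) ⟩
    valueAt (ℓ + length w) (d ∷ x) + valueAt ℓ w ∎
    where
    open ≡-Reasoning
    position : ℓ + length (x ++ w) ≡ ℓ + length w + length x
    position = trans (cong (ℓ +_) (trans (length-++ x) (+-comm (length x) (length w)))) (sym (+-assoc ℓ (length w) (length x)))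

  valLSB-∷ʳ : ∀ i ds d → valLSB S i (ds ∷ʳ d) ≡ toℕ d * V (i + length ds) + valLSB S i ds
  valLSB-∷ʳ i []       d = cong (λ n → toℕ d * V n + 0) (sym (+-identityʳ i))
  valLSB-∷ʳ i (e ∷ ds) d = begin
    toℕ e * V i + valLSB S (suc i) (ds ∷ʳ d)
      ≡⟨ cong (toℕ e * V i +_) (valLSB-∷ʳ (suc i) ds d) ⟩
    toℕ e * V i + (toℕ d * V (suc i + length ds) + valLSB S (suc i) ds)
      ≡⟨ sym (+-assoc (toℕ e * V i) _ _) ⟩
    toℕ e * V i + toℕ d * V (suc i + length ds) + valLSB S (suc i) ds
      ≡⟨ cong (_+ valLSB S (suc i) ds) (+-comm (toℕ e * V i) _) ⟩
    toℕ d * V (suc i + length ds) + toℕ e * V i + valLSB S (suc i) ds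
      ≡⟨ +-assoc (toℕ d * V (suc i + length ds)) _ _ ⟩
    toℕ d * V (suc i + length ds) + (toℕ e * V i + valLSB S (suc i) ds)
      ≡⟨ cong (λ n → toℕ d * V n + (toℕ e * V i + valLSB S (suc i) ds)) (sym (+-suc i (length ds))) ⟩
    toℕ d * V (i + suc (length ds)) + (toℕ e * V i + valLSB S (suc i) ds) ∎
    where open ≡-Reasoning

  val≡value : ∀ w → val S w ≡ value w
  val≡value []      = refl
  val≡value (d ∷ w) = begin
    valLSB S 0 (reverse (d ∷ w))   ≡⟨ cong (valLSB S 0) (unfold-reverse d w) ⟩
    valLSB S 0 (reverse w ∷ʳ d)    ≡⟨ valLSB-∷ʳ 0 (reverse w) d ⟩
    toℕ d * V (length (reverse w)) + valLSB S 0 (reverse w)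
      ≡⟨ cong₂ (λ n v → toℕ d * V n + v) (length-reverse w) (val≡value w) ⟩
    value (d ∷ w) ∎
    where open ≡-Reasoning

  -- Structural in the most significant digit, so that prefixes can be put in front; the nonzero
  -- leading digit is kept as a separate condition.
  Greedy : Word S → Set
  Greedy []      = ⊤
  Greedy (d ∷ w) = value (d ∷ w) < V (suc (length w)) × Greedy w

  LeadingNonzero : Word S → Set
  LeadingNonzero []      = ⊤
  LeadingNonzero (d ∷ _) = toℕ d ≢ 0

  private
    take-∷ʳ : ∀ t (xs : Word S) d → t < length xs → take (suc t) (xs ∷ʳ d) ≡ take (suc t) xs
    take-∷ʳ zero    (x ∷ xs) d _         = refl
    take-∷ʳ (suc t) (x ∷ xs) d (s≤s t<n) = cong (x ∷_) (take-∷ʳ t xs d t<n)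

    length-∷ʳ : ∀ (xs : Word S) d → length (xs ∷ʳ d) ≡ suc (length xs)
    length-∷ʳ xs d = trans (length-++ xs) (+-comm (length xs) 1)

    value-reverse : ∀ d w → valLSB S 0 (take (suc (length w)) (reverse w ∷ʳ d)) ≡ value (d ∷ w)
    value-reverse d w = begin
      valLSB S 0 (take (suc (length w)) (reverse w ∷ʳ d))
        ≡⟨ cong (valLSB S 0) (take-all (suc (length w)) (reverse w ∷ʳ d)
             (≤-reflexive (trans (length-∷ʳ (reverse w) d) (cong suc (length-reverse w))))) ⟩
      valLSB S 0 (reverse w ∷ʳ d) ≡⟨ cong (valLSB S 0) (sym (unfold-reverse d w)) ⟩
      val S (d ∷ w)               ≡⟨ val≡value (d ∷ w) ⟩
      value (d ∷ w) ∎
      where open ≡-Reasoning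

  GreedyLSB⇒Greedy : ∀ w → GreedyLSB S (reverse w) → Greedy w
  GreedyLSB⇒Greedy []      g = tt
  GreedyLSB⇒Greedy (d ∷ w) g =
    subst (_< V (suc (length w))) (value-reverse d w) (g′ (length w) (s≤s (≤-reflexive (sym (length-reverse w))))) ,
    GreedyLSB⇒Greedy w (λ t t<n → subst (λ xs → valLSB S 0 xs < V (suc t)) (take-∷ʳ t (reverse w) d t<n) (g′ t (m<n⇒m<1+n t<n)))
    where
    g′ : ∀ t → t < suc (length (reverse w)) → valLSB S 0 (take (suc t) (reverse w ∷ʳ d)) < V (suc t)
    g′ t t< = subst (λ xs → valLSB S 0 (take (suc t) xs) < V (suc t)) (unfold-reverse d w)
      (g t (subst (t <_) (sym (trans (cong length (unfold-reverse d w)) (length-∷ʳ (reverse w) d))) t<))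

  Greedy⇒GreedyLSB : ∀ w → Greedy w → GreedyLSB S (reverse w)
  Greedy⇒GreedyLSB (d ∷ w) (v< , g) = subst (GreedyLSB S) (sym (unfold-reverse d w)) greedy
    where
    greedy : GreedyLSB S (reverse w ∷ʳ d)
    greedy t t< with m≤n⇒m<n∨m≡n (s≤s⁻¹ (subst (t <_) (length-∷ʳ (reverse w) d) t<))
    ... | inj₁ t<n = subst (λ xs → valLSB S 0 xs < V (suc t)) (sym (take-∷ʳ t (reverse w) d t<n)) (Greedy⇒GreedyLSB w g t t<n)
    ... | inj₂ t≡n rewrite trans t≡n (length-reverse w) = subst (_< V (suc (length w))) (sym (value-reverse d w)) v<

  InRep⇒Greedy : ∀ w → InRep S w → Greedy w × LeadingNonzero w
  InRep⇒Greedy _ (inj₁ refl)                       = tt , tt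
  InRep⇒Greedy _ (inj₂ (d , w , refl , d≢0 , g)) = GreedyLSB⇒Greedy (d ∷ w) g , d≢0

  Greedy⇒InRep : ∀ w → Greedy w → LeadingNonzero w → InRep S w
  Greedy⇒InRep []      _ _   = inj₁ refl
  Greedy⇒InRep (d ∷ w) g d≢0 = inj₂ (d , w , refl , d≢0 , Greedy⇒GreedyLSB (d ∷ w) g)

  Greedy⇒value< : ∀ w → Greedy w → value w < V (length w)
  Greedy⇒value< []      _        = U-positive S 0
  Greedy⇒value< (d ∷ w) (v< , _) = v<

  U≤value : ∀ d w → toℕ d ≢ 0 → V (length w) ≤ value (d ∷ w)
  U≤value d w d≢0 = ≤-trans (m≤n*m (V (length w)) (toℕ d) {{≢-nonZero d≢0}}) (m≤m+n _ (value w))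

  length≤value : ∀ w → LeadingNonzero w → length w ≤ value w
  length≤value []      _   = z≤n
  length≤value (d ∷ w) d≢0 = ≤-trans (i<U (length w)) (U≤value d w d≢0)

  -- Division by `V ℓ` yields the leading digit, and `C-bound` makes the quotient a digit.
  greedyWord : ∀ ℓ v → v < V ℓ → ∃ λ w → length w ≡ ℓ × Greedy w × value w ≡ v
  greedyWord zero    v v< = [] , refl , tt , sym (n<1⇒n≡0 (subst (v <_) (U0≡1 S) v<))
  greedyWord (suc ℓ) v v< with greedyWord ℓ (_%_ v (V ℓ) {{>-nonZero (U-positive S ℓ)}}) (m%n<n v (V ℓ) {{>-nonZero (U-positive S ℓ)}})
  ... | w , refl , g , eq = d ∷ w , refl , (subst (_< V (suc ℓ)) (sym value≡v) v< , g) , value≡v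
    where
    instance _ = >-nonZero (U-positive S ℓ)
    q<C : v / V ℓ < C S
    q<C = m<n*o⇒m/o<n (<-≤-trans v< (C-bound S ℓ))
    d = fromℕ< q<C
    value≡v : toℕ d * V ℓ + value w ≡ v
    value≡v = trans (cong₂ (λ x y → x * V ℓ + y) (toℕ-fromℕ< q<C) eq)
                    (trans (+-comm (v / V ℓ * V ℓ) (v % V ℓ)) (sym (m≡m%n+[m/n]*n v (V ℓ))))

  private
    quotient-≤ : ∀ {n} q r q′ r′ → r < n → q * n + r ≡ q′ * n + r′ → q′ ≤ q
    quotient-≤ {n} q r q′ r′ r<n eq = ≮⇒≥ λ q<q′ → <⇒≢ (begin-strict
      q * n + r    <⟨ +-monoʳ-< (q * n) r<n ⟩
      q * n + n    ≡⟨ +-comm (q * n) n ⟩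
      suc q * n    ≤⟨ *-monoˡ-≤ n q<q′ ⟩
      q′ * n       ≤⟨ m≤m+n (q′ * n) r′ ⟩
      q′ * n + r′  ∎) eq
      where open ≤-Reasoning

  Greedy-injective : ∀ w w′ → length w ≡ length w′ → Greedy w → Greedy w′ → value w ≡ value w′ → w ≡ w′
  Greedy-injective []      []        _   _       _        _  = refl
  Greedy-injective (d ∷ w) (d′ ∷ w′) len (_ , g) (_ , g′) eq = cong₂ _∷_ (toℕ-injective d≡d′) (Greedy-injective w w′ len′ g g′ tail≡)
    where
    len′ = suc-injective len
    r<  = Greedy⇒value< w g
    r′< = subst (λ n → value w′ < V n) (sym len′) (Greedy⇒value< w′ g′)
    eq′ : toℕ d * V (length w) + value w ≡ toℕ d′ * V (length w) + value w′
    eq′ = trans eq (cong (λ n → toℕ d′ * V n + value w′) (sym len′))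
    d≡d′ : toℕ d ≡ toℕ d′
    d≡d′ = ≤-antisym (quotient-≤ (toℕ d′) (value w′) (toℕ d) (value w) r′< (sym eq′))
                     (quotient-≤ (toℕ d) (value w) (toℕ d′) (value w′) r< eq′)
    tail≡ : value w ≡ value w′
    tail≡ = +-cancelˡ-≡ (toℕ d * V (length w)) _ _ (trans eq′ (cong (λ x → x * V (length w) + value w′) (sym d≡d′)))

  length-≤ : ∀ w w′ → Greedy w → LeadingNonzero w′ → value w ≡ value w′ → length w′ ≤ length w
  length-≤ w []        _ _   _  = z≤n
  length-≤ w (d ∷ w′) g d≢0 eq = ≰⇒> λ len≤ →
    <⇒≱ (Greedy⇒value< w g) (≤-trans (U-mono len≤) (≤-trans (U≤value d w′ d≢0) (≤-reflexive (sym eq))))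

  rep-unique : ∀ w w′ → Greedy w → LeadingNonzero w → Greedy w′ → LeadingNonzero w′ → value w ≡ value w′ → w ≡ w′
  rep-unique w w′ g l g′ l′ eq =
    Greedy-injective w w′ (≤-antisym (length-≤ w′ w g′ l (sym eq)) (length-≤ w w′ g l′ eq)) g g′ eq

  rep : ∀ n → ∃ λ w → Greedy w × LeadingNonzero w × value w ≡ n
  rep n with greedyWord n n (i<U n)
  ... | w , _ , g , refl = strip w g
    where
    strip : ∀ w → Greedy w → ∃ λ w′ → Greedy w′ × LeadingNonzero w′ × value w′ ≡ value w
    strip []      g = [] , tt , tt , refl
    strip (d ∷ w) g with toℕ d ≟ 0
    ... | no d≢0 = d ∷ w , g , d≢0 , refl
    ... | yes d≡0 with strip w (proj₂ g)
    ...   | w′ , g′ , l′ , eq = w′ , g′ , l′ , trans eq (cong (λ x → x * V (length w) + value w) (sym d≡0))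

  -- By uniqueness of the greedy representation, the word witnessing that `value w` is recognized
  -- can only be `w`.
  Recognized⇔Accepts : (A : DFA (C S)) → (∀ w → Accepts A w → InRep S w) →
    ∀ w → Greedy w → LeadingNonzero w → Recognized S A (value w) ⇔ Accepts A w
  Recognized⇔Accepts A A⊆rep w g l = mk⇔ to (λ acc → w , acc , val≡value w)
    where
    to : Recognized S A (value w) → Accepts A w
    to (w′ , acc , eq) with InRep⇒Greedy w′ (A⊆rep w′ acc)
    ... | g′ , l′ = subst (Accepts A) (rep-unique w′ w g′ l′ g l (trans (sym (val≡value w′)) eq)) acc

-- Runs, and eventual periodicity from the pigeonhole principle.

run-++ : ∀ {c} (A : DFA c) q x w → run A q (x ++ w) ≡ run A (run A q x) w
run-++ A q []      w = refl
run-++ A q (d ∷ x) w = run-++ A (δ A q d) x w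

-- No transition function on `Fin M` is required: it is enough that equal states past `N` have equal
-- successors.
eventuallyPeriodic : ∀ {M} (s : ℕ → Fin M) N →
  (∀ i j → N ≤ i → N ≤ j → s i ≡ s j → s (suc i) ≡ s (suc j)) →
  ∃₂ λ L e → N ≤ L × 0 < e × (∀ i → L ≤ i → s (i + e) ≡ s i)
eventuallyPeriodic {M} s N deterministic with pigeonhole (n<1+n M) (λ t → s (N + toℕ t))
... | i , j , i<j , eq = L , e , m≤m+n N (toℕ i) , m<n⇒0<n∸m i<j , periodic
  where
  L = N + toℕ i
  e = toℕ j ∸ toℕ i
  L+e : L + e ≡ N + toℕ j
  L+e = trans (+-assoc N (toℕ i) e) (cong (N +_) (m+[n∸m]≡n (<⇒≤ i<j)))
  periodic-from : ∀ t → s (t + (L + e)) ≡ s (t + L)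
  periodic-from zero    = trans (cong s L+e) (sym eq)
  periodic-from (suc t) = deterministic (t + (L + e)) (t + L) (N≤ (≤-trans (m≤m+n L e) (m≤n+m _ t))) (N≤ (m≤n+m L t)) (periodic-from t)
    where
    N≤ : ∀ {x} → L ≤ x → N ≤ x
    N≤ = ≤-trans (m≤m+n N (toℕ i))
  periodic : ∀ x → L ≤ x → s (x + e) ≡ s x
  periodic x L≤x = subst (λ y → s (y + e) ≡ s y) (m∸n+n≡m L≤x)
    (trans (cong s (+-assoc (x ∸ L) L e)) (periodic-from (x ∸ L)))

periodic-multiple : ∀ {A : Set} (f : ℕ → A) {L e} → (∀ i → L ≤ i → f (i + e) ≡ f i) →
  ∀ t i → L ≤ i → f (i + t * e) ≡ f i
periodic-multiple f         periodic zero    i L≤i = cong f (+-identityʳ i)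
periodic-multiple f {e = e} periodic (suc t) i L≤i = trans
  (cong f (trans (cong (i +_) (+-comm e (t * e))) (sym (+-assoc i (t * e) e))))
  (trans (periodic (i + t * e) (≤-trans L≤i (m≤m+n i _))) (periodic-multiple f periodic t i L≤i))

-- Congruences, and the sequence U modulo π.

module Residues (π : ℕ) .{{_ : NonZero π}} where

  infix 4 _≈_
  _≈_ : ℕ → ℕ → Set
  a ≈ b = a % π ≡ b % π

  +-≈ : ∀ {a b c d} → a ≈ b → c ≈ d → a + c ≈ b + d
  +-≈ {a} {b} {c} {d} a≈b c≈d =
    trans (%-distribˡ-+ a c π) (trans (cong₂ (λ x y → (x + y) % π) a≈b c≈d) (sym (%-distribˡ-+ b d π)))

  *-≈ : ∀ {a b c d} → a ≈ b → c ≈ d → a * c ≈ b * d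
  *-≈ {a} {b} {c} {d} a≈b c≈d =
    trans (%-distribˡ-* a c π) (trans (cong₂ (λ x y → (x * y) % π) a≈b c≈d) (sym (%-distribˡ-* b d π)))

  -- The coefficients of the recurrence may be negative, so congruences of naturals are transported
  -- to ℤ to be propagated along it.
  ≈⇒∣ : ∀ a b → a ≈ b → ℤ.+ π ℤ∣.∣ ℤ.+ a ℤ.- ℤ.+ b
  ≈⇒∣ a b a≈b = ℤ∣.divides (ℤ.+ (a / π) ℤ.- ℤ.+ (b / π)) (trans
    (cong₂ ℤ._-_ (split a) (trans (split b) (cong (λ r → ℤ.+ r ℤ.+ ℤ.+ (b / π) ℤ.* ℤ.+ π) (sym a≈b))))
    (cancel (ℤ.+ (a % π)) (ℤ.+ (a / π)) (ℤ.+ (b / π)) (ℤ.+ π)))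
    where
    split : ∀ n → ℤ.+ n ≡ ℤ.+ (n % π) ℤ.+ ℤ.+ (n / π) ℤ.* ℤ.+ π
    split n = trans (cong ℤ.+_ (m≡m%n+[m/n]*n n π)) (cong (λ x → ℤ.+ (n % π) ℤ.+ x) (ℤ.pos-* (n / π) π))
    cancel : ∀ r x y p → (r ℤ.+ x ℤ.* p) ℤ.- (r ℤ.+ y ℤ.* p) ≡ (x ℤ.- y) ℤ.* p
    cancel = ℤSolver.solve-∀

  ∣⇒≈ : ∀ a b → ℤ.+ π ℤ∣.∣ ℤ.+ a ℤ.- ℤ.+ b → a ≈ b
  ∣⇒≈ a b (ℤ∣.divides (ℤ.+ n) eq) = trans (cong (_% π) a≡) ([m+kn]%n≡m%n b n π)
    where
    rearrange : ∀ x y → x ≡ y ℤ.+ (x ℤ.- y)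
    rearrange = ℤSolver.solve-∀
    a≡ : a ≡ b + n * π
    a≡ = ℤ.+-injective (trans (rearrange (ℤ.+ a) (ℤ.+ b)) (cong (λ x → ℤ.+ b ℤ.+ x) (trans eq (sym (ℤ.pos-* n π)))))
  ∣⇒≈ a b (ℤ∣.divides ℤ.-[1+ n ] eq) = sym (trans (cong (_% π) b≡) ([m+kn]%n≡m%n a (suc n) π))
    where
    rearrange : ∀ x y → y ≡ x ℤ.+ ℤ.- (x ℤ.- y)
    rearrange = ℤSolver.solve-∀
    b≡ : b ≡ a + suc n * π
    b≡ = ℤ.+-injective (trans (rearrange (ℤ.+ a) (ℤ.+ b)) (cong (λ x → ℤ.+ a ℤ.+ x)
      (trans (cong ℤ.-_ eq) (trans (ℤ.neg-distribˡ-* ℤ.-[1+ n ] (ℤ.+ π)) (sym (ℤ.pos-* (suc n) π))))))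

  sumFinℤ-∣ : ∀ n (a : Fin n → ℤ.ℤ) (v v′ : Fin n → ℤ.ℤ) → (∀ j → ℤ.+ π ℤ∣.∣ v j ℤ.- v′ j) →
    ℤ.+ π ℤ∣.∣ sumFinℤ n (λ j → a j ℤ.* v j) ℤ.- sumFinℤ n (λ j → a j ℤ.* v′ j)
  sumFinℤ-∣ zero    a v v′ π∣ = ℤ∣.divides (ℤ.+ 0) refl
  sumFinℤ-∣ (suc n) a v v′ π∣ = subst (ℤ.+ π ℤ∣.∣_)
    (regroup (a fzero) (v fzero) (v′ fzero) (sumFinℤ n (λ j → a (fsuc j) ℤ.* v (fsuc j))) (sumFinℤ n (λ j → a (fsuc j) ℤ.* v′ (fsuc j))))
    (ℤ∣.∣m∣n⇒∣m+n (ℤ∣.∣n⇒∣m*n (a fzero) (π∣ fzero)) (sumFinℤ-∣ n (a ∘ fsuc) (v ∘ fsuc) (v′ ∘ fsuc) (π∣ ∘ fsuc)))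
    where
    regroup : ∀ a v v′ s s′ → a ℤ.* (v ℤ.- v′) ℤ.+ (s ℤ.- s′) ≡ (a ℤ.* v ℤ.+ s) ℤ.- (a ℤ.* v′ ℤ.+ s′)
    regroup = ℤSolver.solve-∀

  module Window (S : LinearNumerationSystem) where
    private
      k = suc (m S)

    residue : ℕ → Fin k → Fin π
    residue i j = fromℕ< (m%n<n (U S (i + toℕ j)) π)

    -- By the recurrence, `k` consecutive residues determine the next one; coding them in a finite
    -- type makes `eventuallyPeriodic` applicable.
    window : ℕ → Fin (π ^ k)
    window i = funToFin (residue i)

    window⇒≈ : ∀ i j → window i ≡ window j → ∀ t → t < k → U S (i + t) ≈ U S (j + t)
    window⇒≈ i j eq t t<k = subst (λ t → U S (i + t) ≈ U S (j + t)) (toℕ-fromℕ< t<k)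
      (fromℕ<-injective _ _ (m%n<n _ π) (m%n<n _ π)
        (trans (sym (finToFun-funToFin (residue i) t′)) (trans (cong (λ c → finToFun c t′) eq) (finToFun-funToFin (residue j) t′))))
      where t′ = fromℕ< t<k

    funToFin-cong : ∀ {m n} {f g : Fin m → Fin n} → (∀ x → f x ≡ g x) → funToFin f ≡ funToFin g
    funToFin-cong {zero}  eq = refl
    funToFin-cong {suc m} eq = cong₂ combine (eq fzero) (funToFin-cong (eq ∘ fsuc))

    window-deterministic : ∀ i j → N S ≤ i → N S ≤ j → window i ≡ window j → window (suc i) ≡ window (suc j)
    window-deterministic i j N≤i N≤j eq = funToFin-cong λ t → toℕ-injective
      (trans (toℕ-fromℕ< (m%n<n _ π)) (trans (shifted (toℕ t) (toℕ<n t)) (sym (toℕ-fromℕ< (m%n<n _ π)))))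
      where
      next : U S (i + k) ≈ U S (j + k)
      next = ∣⇒≈ (U S (i + k)) (U S (j + k)) (subst₂ (λ x y → ℤ.+ π ℤ∣.∣ x ℤ.- y) (sym (rec S i N≤i)) (sym (rec S j N≤j))
        (sumFinℤ-∣ k (a S) (λ t → ℤ.+ U S (i + toℕ t)) (λ t → ℤ.+ U S (j + toℕ t)) (λ t → ≈⇒∣ _ _ (window⇒≈ i j eq (toℕ t) (toℕ<n t)))))
      shifted : ∀ t → t < k → U S (suc i + t) ≈ U S (suc j + t)
      shifted t t<k with m≤n⇒m<n∨m≡n t<k
      ... | inj₁ 1+t<k = subst₂ (λ x y → U S x ≈ U S y) (+-suc i t) (+-suc j t) (window⇒≈ i j eq (suc t) 1+t<k)
      ... | inj₂ refl  = subst₂ (λ x y → U S x ≈ U S y) (+-suc i t) (+-suc j t) next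

    residues-periodic : ∃₂ λ L e → 0 < e × (∀ i → L ≤ i → U S (i + e) ≈ U S i)
    residues-periodic with eventuallyPeriodic window (N S) window-deterministic
    ... | L , e , _ , 0<e , periodic = L , e , 0<e , λ i L≤i →
      subst₂ (λ x y → U S x ≈ U S y) (+-identityʳ (i + e)) (+-identityʳ i) (window⇒≈ (i + e) i (periodic i L≤i) 0 z<s)

-- Prefixes with sparse digits 1, and the residues they realize.

module SparseWords (S : LinearNumerationSystem) (h2 : H2 S) (G : ℕ) (h3 : H3 S G) where
  open Greediness S

  -- (H2) supplies one large gap past `G`, and by (H3) the gaps never shrink afterwards.
  gap-threshold : ∀ B → ∃ λ K → ∀ i → K ≤ i → B < U S (suc i) ∸ U S i
  gap-threshold B with h2 B G
  ... | j , G≤j , B<gap = j , λ i j≤i → go (≤⇒≤′ j≤i)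
    where
    go : ∀ {i} → j ≤′ i → B < U S (suc i) ∸ U S i
    go ≤′-refl = B<gap
    go {suc i} (≤′-step j≤′i) = <-≤-trans (go j≤′i) (h3 i (≤-trans G≤j (≤′⇒≤ j≤′i)))

  1<C : 1 < C S
  1<C = <-≤-trans (subst (_< U S 1) (U0≡1 S) (U-incr S 0))
          (subst (U S 1 ≤_) (trans (cong (C S *_) (U0≡1 S)) (*-identityʳ (C S))) (C-bound S 0))

  private
    zeroDigit oneDigit : Fin (C S)
    zeroDigit = fromℕ< (<-trans z<s 1<C)
    oneDigit  = fromℕ< 1<C

    zeros : ℕ → Word S
    zeros n = replicate n zeroDigit

    valueAt-zeros : ∀ ℓ n → valueAt ℓ (zeros n) ≡ 0
    valueAt-zeros ℓ zero    = refl
    valueAt-zeros ℓ (suc n) =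
      cong₂ (λ x y → x * U S (ℓ + length (zeros n)) + y) (toℕ-fromℕ< (<-trans z<s 1<C)) (valueAt-zeros ℓ n)

    value-zeros-++ : ∀ n w → value (zeros n ++ w) ≡ value w
    value-zeros-++ n w = trans (valueAt-++ 0 (zeros n) w) (cong (_+ value w) (valueAt-zeros (length w) n))

    Greedy-zeros-++ : ∀ n w → Greedy w → Greedy (zeros n ++ w)
    Greedy-zeros-++ zero    w g = g
    Greedy-zeros-++ (suc n) w g =
      subst (_< U S (suc (length (zeros n ++ w)))) (sym (value-zeros-++ (suc n) w))
        (<-≤-trans (Greedy⇒value< w g) (U-mono (m≤n⇒m≤1+n (subst (length w ≤_) (sym (length-++ (zeros n))) (m≤n+m _ _))))) ,
      Greedy-zeros-++ n w g

  -- Greedy words may have leading zeros, so here w takes all values below U ℓ.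
  Extends : ℕ → Word S → Set
  Extends ℓ x = ∀ w → length w ≡ ℓ → Greedy w → Greedy (x ++ w)

  -- Unlike `LeadingNonzero`, this excludes the empty word, so the property survives appending any
  -- word.
  HeadNonzero : Word S → Set
  HeadNonzero []      = ⊥
  HeadNonzero (d ∷ _) = toℕ d ≢ 0

  HeadNonzero-++ : ∀ x y → HeadNonzero x → HeadNonzero (x ++ y)
  HeadNonzero-++ (_ ∷ _) _ d≢0 = d≢0

  HeadNonzero⇒Leading : ∀ x → HeadNonzero x → LeadingNonzero x
  HeadNonzero⇒Leading (_ ∷ _) d≢0 = d≢0

  U≤valueAt : ∀ ℓ x → HeadNonzero x → U S ℓ ≤ valueAt ℓ x
  U≤valueAt ℓ (d ∷ x) d≢0 = ≤-trans (U-mono (m≤m+n ℓ (length x)))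
    (≤-trans (m≤n*m _ (toℕ d) {{≢-nonZero d≢0}}) (m≤m+n _ _))

  -- Once the gap at `P` exceeds `U ℓ`, a tail of value below `U ℓ` keeps the total below
  -- `U (suc P)`. The maximum with `ℓ` leaves room for the tail after the digit 1.
  singleOne : ∀ ℓ → ∃ λ K → ∀ P → K ≤ P → ∃ λ x → Extends ℓ x × HeadNonzero x × valueAt ℓ x ≡ U S P
  singleOne ℓ with gap-threshold (U S ℓ)
  ... | K , gap = K ⊔ ℓ , λ P K≤P → oneDigit ∷ zeros (P ∸ ℓ) , extends P K≤P , head≢0 ,
        trans (valueAt-word P) (cong (U S) (position P (m⊔n≤o⇒n≤o K ℓ K≤P)))
    where
    head≢0 : toℕ oneDigit ≢ 0
    head≢0 eq = contradiction (trans (sym (toℕ-fromℕ< 1<C)) eq) λ ()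
    position : ∀ P → ℓ ≤ P → ℓ + length (zeros (P ∸ ℓ)) ≡ P
    position P ℓ≤P = trans (cong (ℓ +_) (length-replicate (P ∸ ℓ))) (m+[n∸m]≡n ℓ≤P)
    valueAt-word : ∀ P → valueAt ℓ (oneDigit ∷ zeros (P ∸ ℓ)) ≡ U S (ℓ + length (zeros (P ∸ ℓ)))
    valueAt-word P = trans (cong₂ (λ x y → x * U S (ℓ + length (zeros (P ∸ ℓ))) + y) (toℕ-fromℕ< 1<C) (valueAt-zeros ℓ (P ∸ ℓ)))
                           (trans (+-identityʳ _) (+-identityʳ _))
    extends : ∀ P → K ⊔ ℓ ≤ P → Extends ℓ (oneDigit ∷ zeros (P ∸ ℓ))
    extends P K⊔ℓ≤P w refl g = value< , Greedy-zeros-++ (P ∸ ℓ) w g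
      where
      ℓ≤P = m⊔n≤o⇒n≤o K ℓ K⊔ℓ≤P
      length≡P : length (zeros (P ∸ ℓ) ++ w) ≡ P
      length≡P = trans (length-++ (zeros (P ∸ ℓ))) (trans (cong (_+ ℓ) (length-replicate (P ∸ ℓ))) (m∸n+n≡m ℓ≤P))
      value< : value ((oneDigit ∷ zeros (P ∸ ℓ)) ++ w) < U S (suc (length (zeros (P ∸ ℓ) ++ w)))
      value< = subst₂ _<_
        (sym (trans (valueAt-++ 0 (oneDigit ∷ zeros (P ∸ ℓ)) w) (cong (_+ value w) (trans (valueAt-word P) (cong (U S) (position P ℓ≤P))))))
        (cong (λ n → U S (suc n)) (sym length≡P))
        (<-≤-trans (+-monoʳ-< (U S P) (<-trans (Greedy⇒value< w g) (gap P (m⊔n≤o⇒m≤o K ℓ K⊔ℓ≤P))))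
                   (≤-reflexive (m+[n∸m]≡n (<⇒≤ (U-incr S P)))))

  module Realizability (π : ℕ) .{{_ : NonZero π}} where
    open Residues π

    -- Words 10…010…0 with sparse enough digits 1 are greedy whatever greedy word follows;
    -- c is realizable if it is the residue of such prefixes at every position.
    Realizable : ℕ → Set
    Realizable c = ∀ ℓ → ∃ λ x → Extends ℓ x × HeadNonzero x × valueAt ℓ x ≈ c

    realizable-≈ : ∀ {c c′} → c ≈ c′ → Realizable c → Realizable c′
    realizable-≈ c≈c′ real ℓ = let x , ext , head , val≈ = real ℓ in x , ext , head , trans val≈ c≈c′

    -- The left prefix is chosen after the right one, for the position where the latter ends; this
    -- is why realizability quantifies over all `ℓ`.
    realizable-+ : ∀ {c c′} → Realizable c → Realizable c′ → Realizable (c + c′)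
    realizable-+ real real′ ℓ with real′ ℓ
    ... | x , ext-x , _ , val-x with real (ℓ + length x)
    ...   | y , ext-y , head-y , val-y = y ++ x , extends , HeadNonzero-++ y x head-y ,
              trans (cong (_% π) (valueAt-++ ℓ y x)) (+-≈ val-y val-x)
      where
      extends : Extends ℓ (y ++ x)
      extends w refl g = subst Greedy (sym (++-assoc y x w))
        (ext-y (x ++ w) (trans (length-++ x) (+-comm (length x) (length w))) (ext-x w refl g))

    realizable-* : ∀ {c} n → 0 < n → Realizable c → Realizable (n * c)
    realizable-* {c} (suc zero)    _ real = realizable-≈ (cong (_% π) (sym (+-identityʳ c))) real
    realizable-* {c} (suc (suc n)) _ real = realizable-+ real (realizable-* (suc n) z<s real)

    realizable-period : ∀ {c} → Realizable c → Realizable π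
    realizable-period {c} real = realizable-≈
      (trans (cong (_% π) (*-comm π c)) (trans (m*n%n≡0 c π) (sym (n%n≡0 π)))) (realizable-* π (>-nonZero⁻¹ π) real)

    private
      -- Only positive multiples are realizable, so `- y * b` is replaced by `pred π * y * b`, and
      -- adding π to both multipliers keeps them positive without changing the residue.
      realizable-Bézout : ∀ {a b} d x y → d + y * b ≡ x * a → Realizable a → Realizable b → Realizable d
      realizable-Bézout {a} {b} d x y eq real-a real-b = realizable-≈ combination
        (realizable-+ (realizable-* (π + x) (≤-trans 0<π (m≤m+n π x)) real-a)
                      (realizable-* (π + pred π * y) (≤-trans 0<π (m≤m+n π _)) real-b))
        where
        0<π = >-nonZero⁻¹ π
        expand : ∀ p q x y a b → (p + x) * a + (p + q * y) * b ≡ x * a + (q * y * b + p * (a + b))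
        expand = solve-∀
        collect : ∀ q d y a b → d + y * b + (q * y * b + suc q * (a + b)) ≡ d + (a + b + y * b) * suc q
        collect = solve-∀
        combination : (π + x) * a + (π + pred π * y) * b ≈ d
        combination = trans (cong (_% π) (begin
          (π + x) * a + (π + pred π * y) * b           ≡⟨ expand π (pred π) x y a b ⟩
          x * a + (pred π * y * b + π * (a + b))       ≡⟨ cong₂ (λ z p → z + (pred π * y * b + p * (a + b))) (sym eq) (sym (suc-pred π)) ⟩
          d + y * b + (pred π * y * b + suc (pred π) * (a + b)) ≡⟨ collect (pred π) d y a b ⟩
          d + (a + b + y * b) * suc (pred π)           ≡⟨ cong (λ p → d + (a + b + y * b) * p) (suc-pred π) ⟩
          d + (a + b + y * b) * π                      ∎)) ([m+kn]%n≡m%n d (a + b + y * b) π)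
          where open ≡-Reasoning

    realizable-gcd : ∀ {a b} → Realizable a → Realizable b → Realizable (gcd a b)
    realizable-gcd {a} {b} real-a real-b with Bézout.identity (gcd-GCD a b)
    ... | Bézout.+- x y eq = realizable-Bézout (gcd a b) x y eq real-a real-b
    ... | Bézout.-+ x y eq = realizable-Bézout (gcd a b) y x eq real-b real-a

    -- The residue of `U i` recurs at every `i + t * e`; taking `t` to be the threshold `K` of
    -- `singleOne` places the digit 1 far enough to the left.
    realizable-U : ∀ {L e} → 0 < e → (∀ i → L ≤ i → U S (i + e) ≈ U S i) → ∀ i → L ≤ i → Realizable (U S i)
    realizable-U {L} {e} 0<e periodic i L≤i ℓ with singleOne ℓ
    ... | K , at with at (i + K * e) (≤-trans (m≤m*n K e {{>-nonZero 0<e}}) (m≤n+m _ i))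
    ...   | x , ext , head , val≡ = x , ext , head , trans (cong (_% π) val≡) (periodic-multiple (λ n → U S n % π) periodic K i L≤i)

-- Eventual periods and how to decrease them.

EventualPeriod : (ℕ → Set) → ℕ → Set
EventualPeriod X p = ∃ λ n₀ → ∀ n → n₀ ≤ n → X n ⇔ X (n + p)

module EventualPeriods (X : ℕ → Set) (π : ℕ) .{{_ : NonZero π}} (n₀ : ℕ) (periodic : ∀ n → n₀ ≤ n → X n ⇔ X (n + π)) where
  open Residues π

  cast : ∀ {m n} → m ≡ n → X m ⇔ X n
  cast m≡n = mk⇔ (subst X m≡n) (subst X (sym m≡n))

  shift-multiple : ∀ t n → n₀ ≤ n → X n ⇔ X (n + t * π)
  shift-multiple zero    n n₀≤n = cast (sym (+-identityʳ n))
  shift-multiple (suc t) n n₀≤n =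
    cast (+-assoc n π (t * π)) ⇔-∘ (shift-multiple t (n + π) (≤-trans n₀≤n (m≤m+n n π)) ⇔-∘ periodic n n₀≤n)

  -- Both numbers are raised to the common value `m + n / π * π`, which avoids asking which one is
  -- larger.
  ≈⇒⇔ : ∀ m n → n₀ ≤ m → n₀ ≤ n → m ≈ n → X m ⇔ X n
  ≈⇒⇔ m n n₀≤m n₀≤n m≈n =
    ⇔-sym (shift-multiple (m / π) n n₀≤n) ⇔-∘ (cast common ⇔-∘ shift-multiple (n / π) m n₀≤m)
    where
    swap : ∀ r x y → r + x + y ≡ r + y + x
    swap = solve-∀
    common : m + n / π * π ≡ n + m / π * π
    common = begin
      m + n / π * π                     ≡⟨ cong (_+ n / π * π) (m≡m%n+[m/n]*n m π) ⟩
      m % π + m / π * π + n / π * π     ≡⟨ cong (λ r → r + m / π * π + n / π * π) m≈n ⟩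
      n % π + m / π * π + n / π * π     ≡⟨ swap (n % π) (m / π * π) (n / π * π) ⟩
      n % π + n / π * π + m / π * π     ≡⟨ cong (_+ m / π * π) (sym (m≡m%n+[m/n]*n n π)) ⟩
      n + m / π * π                     ∎
      where open ≡-Reasoning

  -- The difference c′ − c is also an eventual period; take its residue mod π.
  smaller-period : ∀ c c′ → n₀ ≤ c → n₀ ≤ c′ → ¬ c ≈ c′ → (∀ v → v < π → X (c + v) ⇔ X (c′ + v)) →
    ∃ λ p → 0 < p × p < π × EventualPeriod X p
  smaller-period c c′ n₀≤c n₀≤c′ c≉c′ agree = p , n≢0⇒n>0 p≢0 , m%n<n _ π , c , eventually
    where
    -- `pred π * c` plays the role of `- c` modulo π.
    p = (c′ + pred π * c) % π
    c+p≈c′ : c + p ≈ c′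
    c+p≈c′ = begin
      (c + p) % π                     ≡⟨ +-≈ {c} {c} {p} {c′ + pred π * c} refl (m%n%n≡m%n _ π) ⟩
      (c + (c′ + pred π * c)) % π     ≡⟨ cong (_% π) (collect c c′ (pred π)) ⟩
      (c′ + c * suc (pred π)) % π     ≡⟨ cong (λ q → (c′ + c * q) % π) (suc-pred π) ⟩
      (c′ + c * π) % π                ≡⟨ [m+kn]%n≡m%n c′ c π ⟩
      c′ % π                          ∎
      where
      open ≡-Reasoning
      collect : ∀ c c′ q → c + (c′ + q * c) ≡ c′ + c * suc q
      collect = solve-∀
    p≢0 : p ≢ 0
    p≢0 p≡0 = c≉c′ (trans (cong (_% π) (sym (trans (cong (c +_) p≡0) (+-identityʳ c)))) c+p≈c′)
    -- Agreement for `v < π` extends to all `v`, because π is a period beyond `n₀` and both `c` and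
    -- `c′` lie there.
    agree-all : ∀ v → X (c + v) ⇔ X (c′ + v)
    agree-all v = reduce c′ n₀≤c′ ⇔-∘ (agree (v % π) (m%n<n v π) ⇔-∘ ⇔-sym (reduce c n₀≤c))
      where
      reduce : ∀ b → n₀ ≤ b → X (b + v % π) ⇔ X (b + v)
      reduce b n₀≤b = ≈⇒⇔ (b + v % π) (b + v) (≤-trans n₀≤b (m≤m+n b _)) (≤-trans n₀≤b (m≤m+n b _))
                        (+-≈ {b} {b} {v % π} {v} refl (m%n%n≡m%n v π))
    eventually : ∀ n → c ≤ n → X n ⇔ X (n + p)
    eventually n c≤n with m≤n⇒∃[o]m+o≡n c≤n
    ... | v , refl = ≈⇒⇔ (c′ + v) (c + v + p) (≤-trans n₀≤c′ (m≤m+n c′ v)) (≤-trans n₀≤c (≤-trans (m≤m+n c v) (m≤m+n _ p)))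
                       (sym (trans (cong (_% π) (rearrange c v p)) (+-≈ {c + p} {c′} {v} {v} c+p≈c′ refl)))
                     ⇔-∘ agree-all v
      where
      rearrange : ∀ c v p → c + v + p ≡ c + p + v
      rearrange = solve-∀

module PeriodBound (S : LinearNumerationSystem) (h2 : H2 S) (G : ℕ) (h3 : H3 S G)
  (R : ℕ) (divisor-bound : ∀ g L → 0 < g → (∀ i → L ≤ i → g ∣ U S i) → g ≤ R)
  (A : DFA (C S)) (A⊆rep : ∀ w → Accepts A w → InRep S w) where
  open Greediness S
  open SparseWords S h2 G h3

  private
    X = Recognized S A
    s = nStates A

  module _ (π : ℕ) .{{_ : NonZero π}} where
    open Residues π
    open Realizability π
    open Window S

    -- The gcd of π and the values of U over one period of U mod π.
    realizable-divisor : ∃ λ g → 0 < g × g ≤ R × Realizable g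
    realizable-divisor with residues-periodic
    ... | L , e , 0<e , periodic = g e , 0<g e , divisor-bound (g e) L (0<g e) g∣U , realizable e
      where
      g : ℕ → ℕ
      g zero    = π
      g (suc t) = gcd (U S (L + t)) (g t)

      g∣π : ∀ t → g t ∣ π
      g∣π zero    = ∣-refl
      g∣π (suc t) = ∣-trans (gcd[m,n]∣n (U S (L + t)) (g t)) (g∣π t)

      g∣U-prefix : ∀ t i → i < t → g t ∣ U S (L + i)
      g∣U-prefix (suc t) i i<1+t with m≤n⇒m<n∨m≡n (s≤s⁻¹ i<1+t)
      ... | inj₁ i<t  = ∣-trans (gcd[m,n]∣n (U S (L + t)) (g t)) (g∣U-prefix t i i<t)
      ... | inj₂ refl = gcd[m,n]∣m (U S (L + t)) (g t)

      realizable-Ui : ∀ i → L ≤ i → Realizable (U S i)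
      realizable-Ui = realizable-U 0<e periodic

      realizable : ∀ t → Realizable (g t)
      realizable zero    = realizable-period (realizable-Ui L ≤-refl)
      realizable (suc t) = realizable-gcd (realizable-Ui (L + t) (m≤m+n L t)) (realizable t)

      0<g : ∀ t → 0 < g t
      0<g t = n≢0⇒n>0 λ g≡0 → ≢-nonZero⁻¹ π (0∣⇒≡0 (subst (_∣ π) g≡0 (g∣π t)))

      -- As `g e` divides π, whether it divides a term of U depends only on the residue of that term
      -- modulo π, and those residues have period `e`.
      g∣U-offset : ∀ i → g e ∣ U S (L + i)
      g∣U-offset = <-rec (λ i → g e ∣ U S (L + i)) λ i IH → step i IH
        where
        step : ∀ i → (∀ {j} → j < i → g e ∣ U S (L + j)) → g e ∣ U S (L + i)
        step i IH with i <? e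
        ... | yes i<e = g∣U-prefix e i i<e
        ... | no i≮e = ∣n∣m%n⇒∣m (g∣π e) (subst (g e ∣_) (sym U≈) (%-presˡ-∣ (IH (∸-monoʳ-< 0<e e≤i)) (g∣π e)))
          where
          e≤i = ≮⇒≥ i≮e
          U≈ : U S (L + i) ≈ U S (L + (i ∸ e))
          U≈ = trans (cong (λ n → U S n % π) (trans (cong (L +_) (sym (m∸n+n≡m e≤i))) (sym (+-assoc L (i ∸ e) e))))
                     (periodic (L + (i ∸ e)) (m≤m+n L _))

      g∣U : ∀ i → L ≤ i → g e ∣ U S i
      g∣U i L≤i = subst (λ n → g e ∣ U S n) (m+[n∸m]≡n L≤i) (g∣U-offset (i ∸ L))

    -- The multiplier `π + t` has the same effect modulo π as `t` but is positive even at `t = 0`.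
    -- For `t ≤ s` the product `t * g` is at most `s * R`, hence is its own residue.
    module Shrinking (n₀ : ℕ) (periodic : ∀ n → n₀ ≤ n → X n ⇔ X (n + π)) (sR<π : s * R < π)
      (g : ℕ) (0<g : 0 < g) (g≤R : g ≤ R)
      (word : ∀ t → ∃ λ x → Extends (n₀ + π) x × HeadNonzero x × valueAt (n₀ + π) x ≈ (π + t) * g) where

      private
        -- Since `U ℓ` exceeds `n₀ + π`, the values of the prefixes lie beyond `n₀`, and every
        -- `v < π` has a greedy word of length `ℓ`.
        ℓ = n₀ + π

      x : ℕ → Word S
      x t = proj₁ (word t)
      c : ℕ → ℕ
      c t = valueAt ℓ (x t)

      n₀≤c : ∀ t → n₀ ≤ c t
      n₀≤c t = ≤-trans (m≤m+n n₀ π) (≤-trans (<⇒≤ (i<U ℓ)) (U≤valueAt ℓ (x t) (proj₁ (proj₂ (proj₂ (word t))))))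

      residue-c : ∀ t → t ≤ s → c t % π ≡ t * g
      residue-c t t≤s = trans (proj₂ (proj₂ (proj₂ (word t)))) (trans (cong (_% π) (expand π t g))
        (trans ([m+kn]%n≡m%n (t * g) g π) (m<n⇒m%n≡m (≤-<-trans (*-mono-≤ t≤s g≤R) sR<π))))
        where
        expand : ∀ p t g → (p + t) * g ≡ t * g + g * p
        expand = solve-∀

      accepted : ∀ t w → length w ≡ ℓ → Greedy w → X (c t + value w) ⇔ (final A (run A (run A (start A) (x t)) w) ≡ true)
      accepted t w length≡ℓ greedy =
        mk⇔ (subst (λ q → final A q ≡ true) (run-++ A (start A) (x t) w)) (subst (λ q → final A q ≡ true) (sym (run-++ A (start A) (x t) w)))
        ⇔-∘ (Recognized⇔Accepts A A⊆rep (x t ++ w) (extends w length≡ℓ greedy) (HeadNonzero⇒Leading (x t ++ w) (HeadNonzero-++ (x t) w head≢0))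
        ⇔-∘ mk⇔ (subst X (sym value≡)) (subst X value≡))
        where
        extends = proj₁ (proj₂ (word t))
        head≢0  = proj₁ (proj₂ (proj₂ (word t)))
        value≡ : value (x t ++ w) ≡ c t + value w
        value≡ = trans (valueAt-++ 0 (x t) w) (cong (λ n → valueAt n (x t) + value w) length≡ℓ)

      smaller : ∃ λ p → 0 < p × p < π × EventualPeriod X p
      smaller with pigeonhole (n<1+n s) (λ t → run A (start A) (x (toℕ t)))
      ... | i , j , i<j , same-state =
        EventualPeriods.smaller-period X π n₀ periodic (c (toℕ i)) (c (toℕ j)) (n₀≤c (toℕ i)) (n₀≤c (toℕ j)) distinct agree
        where
        distinct : ¬ c (toℕ i) ≈ c (toℕ j)
        distinct eq = <⇒≢ i<j (*-cancelʳ-≡ (toℕ i) (toℕ j) g {{>-nonZero 0<g}}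
          (trans (sym (residue-c (toℕ i) (s≤s⁻¹ (toℕ<n i)))) (trans eq (residue-c (toℕ j) (s≤s⁻¹ (toℕ<n j))))))
        agree : ∀ v → v < π → X (c (toℕ i) + v) ⇔ X (c (toℕ j) + v)
        agree v v<π with greedyWord ℓ v (<-trans v<π (≤-<-trans (m≤n+m π n₀) (i<U ℓ)))
        ... | w , length≡ℓ , greedy , refl = ⇔-sym (accepted (toℕ j) w length≡ℓ greedy) ⇔-∘
              (mk⇔ (subst (λ q → final A (run A q w) ≡ true) same-state) (subst (λ q → final A (run A q w) ≡ true) (sym same-state))
              ⇔-∘ accepted (toℕ i) w length≡ℓ greedy)

    shrink : EventualPeriod X π → s * R < π → ∃ λ p → 0 < p × p < π × EventualPeriod X p
    shrink (n₀ , periodic) sR<π with realizable-divisor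
    ... | g , 0<g , g≤R , real-g = Shrinking.smaller n₀ periodic sR<π g 0<g g≤R
            (λ t → realizable-* {g} (π + t) (≤-trans (>-nonZero⁻¹ π) (m≤m+n π t)) real-g (n₀ + π))

  private
    BoundedPeriod : Set
    BoundedPeriod = ∃ λ p → p < suc (s * R) × 0 < p × EventualPeriod X p

  bounded-period : ∀ p → 0 < p → EventualPeriod X p → BoundedPeriod
  bounded-period = <-rec (λ p → 0 < p → EventualPeriod X p → BoundedPeriod) step
    where
    step : ∀ p → (∀ {p′} → p′ < p → 0 < p′ → EventualPeriod X p′ → BoundedPeriod) → 0 < p → EventualPeriod X p → BoundedPeriod
    step p IH 0<p period with p ≤? s * R
    ... | yes p≤sR = p , s≤s p≤sR , 0<p , period
    ... | no  p≰sR = let p′ , 0<p′ , p′<p , period′ = shrink p {{>-nonZero 0<p}} period (≰⇒> p≰sR) in IH p′<p 0<p′ period′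

-- Deciding whether a given π is an eventual period.

bit : {P : Set} → Dec P → Fin 2
bit (yes _) = 1F
bit (no _)  = 0F

bit-transport : ∀ {P Q : Set} (P? : Dec P) (Q? : Dec Q) → bit P? ≡ bit Q? → P → Q
bit-transport _        (yes q) _ _ = q
bit-transport (no ¬p) (no _)  _ p = contradiction p ¬p

-- Acceptance by B within a residue class, length by length. Prepending a digit shows that the table of
-- all states and residues, together with a window of U mod π, evolves deterministically, hence periodically.
module ResidueClass (S : LinearNumerationSystem) (B : DFA (C S)) (π : ℕ) .{{_ : NonZero π}} (r : ℕ) where
  open Greediness S
  open Residues π
  open Window S

  -- `c` accumulates the contribution of digits already read; it matters only modulo π, so finitely
  -- many pairs of `q` and `c` describe each length.
  Reaches : ℕ → Fin (nStates B) → ℕ → Set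
  Reaches ℓ q c = ∃ λ w → length w ≡ ℓ × final B (run B q w) ≡ true × (c + value w) % π ≡ r

  Reaches-≈ : ∀ {ℓ q c c′} → c ≈ c′ → Reaches ℓ q c → Reaches ℓ q c′
  Reaches-≈ {c = c} {c′} c≈c′ (w , len , acc , res) =
    w , len , acc , trans (sym (+-≈ {c} {c′} {value w} {value w} c≈c′ refl)) res

  Reaches-∷ : ∀ {ℓ q c} d → Reaches ℓ (δ B q d) (c + toℕ d * U S ℓ) → Reaches (suc ℓ) q c
  Reaches-∷ {c = c} d (w , refl , acc , res) =
    d ∷ w , refl , acc , trans (cong (_% π) (sym (+-assoc c (toℕ d * U S (length w)) (value w)))) res

  Reaches-uncons : ∀ {ℓ q c} → Reaches (suc ℓ) q c → ∃ λ d → Reaches ℓ (δ B q d) (c + toℕ d * U S ℓ)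
  Reaches-uncons {c = c} (d ∷ w , refl , acc , res) =
    d , w , refl , acc , trans (cong (_% π) (+-assoc c (toℕ d * U S (length w)) (value w))) res

  Reaches? : ∀ ℓ q c → Dec (Reaches ℓ q c)
  Reaches? zero q c = map′ (λ { (acc , res) → [] , refl , acc , res }) (λ { ([] , _ , acc , res) → acc , res })
                        ((final B q Bool.≟ true) ×-dec ((c + 0) % π ≟ r))
  Reaches? (suc ℓ) q c = map′ (λ { (d , reach) → Reaches-∷ d reach }) Reaches-uncons
                           (any? λ d → Reaches? ℓ (δ B q d) (c + toℕ d * U S ℓ))

  table : ℕ → Fin (nStates B * π) → Fin 2
  table ℓ x = bit (Reaches? ℓ (proj₁ (remQuot π x)) (toℕ (proj₂ (remQuot {nStates B} π x))))

  code : ℕ → Fin (2 ^ (nStates B * π) * π ^ suc (m S))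
  code ℓ = combine (funToFin (table ℓ)) (window ℓ)

  code⇒window : ∀ i j → code i ≡ code j → window i ≡ window j
  code⇒window i j eq = proj₂ (combine-injective (funToFin (table i)) (window i) (funToFin (table j)) (window j) eq)

  code⇒Reaches : ∀ i j → code i ≡ code j → ∀ q c → Reaches i q c → Reaches j q c
  code⇒Reaches i j eq q c reach = Reaches-≈ (m%n%n≡m%n c π) (at (c % π) (m%n<n c π) (Reaches-≈ (sym (m%n%n≡m%n c π)) reach))
    where
    tables≡ : ∀ x → table i x ≡ table j x
    tables≡ x = trans (sym (finToFun-funToFin (table i) x))
      (trans (cong (λ f → finToFun f x) (proj₁ (combine-injective (funToFin (table i)) (window i) (funToFin (table j)) (window j) eq)))
             (finToFun-funToFin (table j) x))
    at : ∀ c → c < π → Reaches i q c → Reaches j q c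
    at c c<π reach = subst (λ c → Reaches j q c) (toℕ-fromℕ< c<π)
      (bit-transport (Reaches? i q (toℕ c′)) (Reaches? j q (toℕ c′)) bits≡ (subst (Reaches i q) (sym (toℕ-fromℕ< c<π)) reach))
      where
      c′ = fromℕ< c<π
      bits≡ : bit (Reaches? i q (toℕ c′)) ≡ bit (Reaches? j q (toℕ c′))
      bits≡ = subst (λ qc → bit (Reaches? i (proj₁ qc) (toℕ (proj₂ qc))) ≡ bit (Reaches? j (proj₁ qc) (toℕ (proj₂ qc))))
                (remQuot-combine q c′) (tables≡ (combine q c′))

  code-deterministic : ∀ i j → N S ≤ i → N S ≤ j → code i ≡ code j → code (suc i) ≡ code (suc j)
  code-deterministic i j N≤i N≤j eq = cong₂ combine (funToFin-cong tables≡) (window-deterministic i j N≤i N≤j (code⇒window i j eq))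
    where
    bit-cong : ∀ {P Q : Set} (P? : Dec P) (Q? : Dec Q) → (P → Q) → (Q → P) → bit P? ≡ bit Q?
    bit-cong (yes _) (yes _) _ _ = refl
    bit-cong (no _)  (no _)  _ _ = refl
    bit-cong (yes p) (no ¬q) f _ = contradiction (f p) ¬q
    bit-cong (no ¬p) (yes q) _ g = contradiction (g q) ¬p
    U≈ : ∀ i j → code i ≡ code j → U S i ≈ U S j
    U≈ i j eq = subst₂ (λ x y → U S x ≈ U S y) (+-identityʳ i) (+-identityʳ j) (window⇒≈ i j (code⇒window i j eq) 0 z<s)
    step : ∀ i j → code i ≡ code j → ∀ {q c} → Reaches (suc i) q c → Reaches (suc j) q c
    step i j eq {q} {c} reach with Reaches-uncons reach
    ... | d , reach′ = Reaches-∷ d (Reaches-≈ (+-≈ {c} {c} refl (*-≈ {toℕ d} {toℕ d} refl (U≈ i j eq))) (code⇒Reaches i j eq _ _ reach′))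
    tables≡ : ∀ x → table (suc i) x ≡ table (suc j) x
    tables≡ x = bit-cong (Reaches? (suc i) (proj₁ (remQuot π x)) (toℕ (proj₂ (remQuot {nStates B} π x))))
                         (Reaches? (suc j) (proj₁ (remQuot π x)) (toℕ (proj₂ (remQuot {nStates B} π x))))
                         (step i j eq) (step j i (sym eq))

  Sparse Recurrent : Set
  Sparse    = ∃ λ ℓ₀ → ∀ ℓ → ℓ₀ ≤ ℓ → ¬ Reaches ℓ (start B) 0
  Recurrent = ∀ ℓ₀ → ∃ λ ℓ → ℓ₀ ≤ ℓ × Reaches ℓ (start B) 0

  -- Inspecting one period of `code` suffices: a hit recurs at arbitrarily large lengths, and
  -- without a hit no length from `L` on occurs.
  sparse-or-recurrent : Sparse ⊎ Recurrent
  sparse-or-recurrent with eventuallyPeriodic code (N S) code-deterministic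
  ... | L , e , _ , 0<e , periodic with anyUpTo? (λ i → Reaches? (L + i) (start B) 0) e
  ...   | yes (i , _ , reach) = inj₂ λ ℓ₀ → L + i + ℓ₀ * e ,
            ≤-trans (m≤m*n ℓ₀ e {{>-nonZero 0<e}}) (m≤n+m _ (L + i)) ,
            code⇒Reaches (L + i) _ (sym (periodic-multiple code periodic ℓ₀ (L + i) (m≤m+n L i))) _ _ reach
  ...   | no none = inj₁ (L , λ ℓ L≤ℓ reach → none ((ℓ ∸ L) % e , m%n<n (ℓ ∸ L) e , code⇒Reaches ℓ _ (reduce ℓ L≤ℓ) _ _ reach))
    where
    instance _ = >-nonZero 0<e
    decompose : ∀ ℓ → L ≤ ℓ → ℓ ≡ L + (ℓ ∸ L) % e + (ℓ ∸ L) / e * e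
    decompose ℓ L≤ℓ = trans (sym (m+[n∸m]≡n L≤ℓ)) (trans (cong (L +_) (m≡m%n+[m/n]*n (ℓ ∸ L) e)) (sym (+-assoc L _ _)))
    reduce : ∀ ℓ → L ≤ ℓ → code ℓ ≡ code (L + (ℓ ∸ L) % e)
    reduce ℓ L≤ℓ = trans (cong code (decompose ℓ L≤ℓ)) (periodic-multiple code periodic ((ℓ ∸ L) / e) (L + (ℓ ∸ L) % e) (m≤m+n L _))

module _ {c} (H A : DFA c) where

  private
    fst : Fin (nStates H * nStates A) → Fin (nStates H)
    fst q = proj₁ (remQuot {nStates H} (nStates A) q)

    snd : Fin (nStates H * nStates A) → Fin (nStates A)
    snd q = proj₂ (remQuot {nStates H} (nStates A) q)

    fst-combine : ∀ q q′ → fst (combine q q′) ≡ q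
    fst-combine q q′ = cong proj₁ (remQuot-combine {nStates H} q q′)

    snd-combine : ∀ q q′ → snd (combine q q′) ≡ q′
    snd-combine q q′ = cong proj₂ (remQuot-combine {nStates H} q q′)

  -- With the automaton of (H1) as `H`, this accepts the representations of the complement of X.
  difference : DFA c
  difference = record
    { nStates = nStates H * nStates A
    ; start   = combine (start H) (start A)
    ; δ       = λ q d → combine (δ H (fst q) d) (δ A (snd q) d)
    ; final   = λ q → final H (fst q) ∧ not (final A (snd q))
    }

  run-difference : ∀ q q′ w → run difference (combine q q′) w ≡ combine (run H q w) (run A q′ w)
  run-difference q q′ []      = refl
  run-difference q q′ (d ∷ w) = trans
    (cong₂ (λ p p′ → run difference (combine (δ H p d) (δ A p′ d)) w) (fst-combine q q′) (snd-combine q q′))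
    (run-difference (δ H q d) (δ A q′ d) w)

  Accepts-difference : ∀ w → Accepts difference w ⇔ (Accepts H w × ¬ Accepts A w)
  Accepts-difference w = subst (λ b → (b ≡ true) ⇔ (Accepts H w × ¬ Accepts A w)) (sym final≡)
                           (conjunction (final H (run H (start H) w)) (final A (run A (start A) w)))
    where
    final≡ : final difference (run difference (start difference) w)
           ≡ final H (run H (start H) w) ∧ not (final A (run A (start A) w))
    final≡ = trans (cong (final difference) (run-difference (start H) (start A) w))
      (cong₂ (λ p p′ → final H p ∧ not (final A p′)) (fst-combine (run H (start H) w) (run A (start A) w))
                                                     (snd-combine (run H (start H) w) (run A (start A) w)))
    conjunction : ∀ x y → (x ∧ not y ≡ true) ⇔ (x ≡ true × ¬ y ≡ true)
    conjunction true  true  = mk⇔ (λ ()) (λ { (_ , ¬t) → contradiction refl ¬t })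
    conjunction true  false = mk⇔ (λ _ → refl , λ ()) (λ _ → refl)
    conjunction false _     = mk⇔ (λ ()) (λ { (() , _) })

uniform-bound : ∀ {P : ℕ → ℕ → Set} → (∀ {t a b} → a ≤ b → P t a → P t b) →
  ∀ n → (∀ t → t < n → ∃ (P t)) → ∃ λ b → ∀ t → t < n → P t b
uniform-bound mono zero    bounds = 0 , λ _ ()
uniform-bound {P} mono (suc n) bounds with uniform-bound mono n (λ t t<n → bounds t (m<n⇒m<1+n t<n)) | bounds n ≤-refl
... | b , below | b′ , at-n = b ⊔ b′ , λ t t<1+n → combined t (m≤n⇒m<n∨m≡n (s≤s⁻¹ t<1+n))
  where
  combined : ∀ t → t < n ⊎ t ≡ n → P t (b ⊔ b′)
  combined t (inj₁ t<n)  = mono (m≤m⊔n b b′) (below t t<n)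
  combined t (inj₂ refl) = mono (m≤n⊔m b b′) at-n

module PeriodDecision (S : LinearNumerationSystem) (h1 : H1 S)
  (A : DFA (C S)) (A⊆rep : ∀ w → Accepts A w → InRep S w) (π : ℕ) .{{_ : NonZero π}} where
  open Greediness S
  open Residues π

  private
    X = Recognized S A
    B = difference (proj₁ h1) A

    module ClassA (r : ℕ) = ResidueClass S A π r
    module ClassB (r : ℕ) = ResidueClass S B π r

    Accepts-B⇒ : ∀ w → Accepts B w → InRep S w × ¬ Accepts A w
    Accepts-B⇒ w acc = let accH , ¬accA = Equivalence.to (Accepts-difference (proj₁ h1) A w) acc
                        in Equivalence.to (proj₂ h1 w) accH , ¬accA

    Accepts-B⇐ : ∀ w → InRep S w → ¬ Accepts A w → Accepts B w
    Accepts-B⇐ w inRep ¬accA = Equivalence.from (Accepts-difference (proj₁ h1) A w) (Equivalence.from (proj₂ h1 w) inRep , ¬accA)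

  Settled : ℕ → Set
  Settled r = ClassA.Sparse r ⊎ ClassB.Sparse r

  settled? : ∀ r → Dec (Settled r)
  settled? r with ClassA.sparse-or-recurrent r | ClassB.sparse-or-recurrent r
  ... | inj₁ sparse | _           = yes (inj₁ sparse)
  ... | inj₂ _      | inj₁ sparse = yes (inj₂ sparse)
  ... | inj₂ recA   | inj₂ recB   = no λ
    { (inj₁ (ℓ₀ , none)) → let ℓ , ℓ₀≤ℓ , reach = recA ℓ₀ in none ℓ ℓ₀≤ℓ reach
    ; (inj₂ (ℓ₀ , none)) → let ℓ , ℓ₀≤ℓ , reach = recB ℓ₀ in none ℓ ℓ₀≤ℓ reach }

  -- If both languages had arbitrarily long words in the class, there would be an element of X and a
  -- non-element, congruent modulo π and both beyond `n₀`, since a representation is no longer than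
  -- its value.
  period⇒settled : EventualPeriod X π → ∀ r → Settled r
  period⇒settled (n₀ , periodic) r with ClassA.sparse-or-recurrent r | ClassB.sparse-or-recurrent r
  ... | inj₁ sparse | _           = inj₁ sparse
  ... | inj₂ _      | inj₁ sparse = inj₂ sparse
  ... | inj₂ recA   | inj₂ recB with recA n₀ | recB n₀
  ...   | _ , n₀≤ℓ , w , refl , acc , res | _ , n₀≤ℓ′ , w′ , refl , acc′ , res′
    with InRep⇒Greedy w (A⊆rep w acc) | Accepts-B⇒ w′ acc′
  ...   | g , l | inRep′ , rejected with InRep⇒Greedy w′ inRep′
  ...   | g′ , l′ = contradiction
      (Equivalence.to (Recognized⇔Accepts A A⊆rep w′ g′ l′)
        (Equivalence.to (EventualPeriods.≈⇒⇔ X π n₀ periodic (value w) (value w′)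
            (≤-trans n₀≤ℓ (length≤value w l)) (≤-trans n₀≤ℓ′ (length≤value w′ l′)) (trans res (sym res′)))
          (Equivalence.from (Recognized⇔Accepts A A⊆rep w g l) acc)))
      rejected

  private
    SettledFrom : ℕ → ℕ → Set
    SettledFrom r ℓ₀ = (∀ ℓ → ℓ₀ ≤ ℓ → ¬ ClassA.Reaches r ℓ (start A) 0) ⊎ (∀ ℓ → ℓ₀ ≤ ℓ → ¬ ClassB.Reaches r ℓ (start B) 0)

    SettledFrom-mono : ∀ {r a b} → a ≤ b → SettledFrom r a → SettledFrom r b
    SettledFrom-mono a≤b (inj₁ none) = inj₁ λ ℓ b≤ℓ → none ℓ (≤-trans a≤b b≤ℓ)
    SettledFrom-mono a≤b (inj₂ none) = inj₂ λ ℓ b≤ℓ → none ℓ (≤-trans a≤b b≤ℓ)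

    settled⇒from : ∀ {r} → Settled r → ∃ (SettledFrom r)
    settled⇒from (inj₁ (ℓ₀ , none)) = ℓ₀ , inj₁ none
    settled⇒from (inj₂ (ℓ₀ , none)) = ℓ₀ , inj₂ none

  settled⇒period : (∀ r → r < π → Settled r) → EventualPeriod X π
  settled⇒period settled with uniform-bound {SettledFrom} SettledFrom-mono π (λ r r<π → settled⇒from (settled r r<π))
  -- A greedy word shorter than `ℓ₀` has value below `U S ℓ₀`, so every number from there on has a
  -- representation of length at least `ℓ₀`.
  ... | ℓ₀ , from-ℓ₀ = U S ℓ₀ , λ n U≤n → decide n U≤n (from-ℓ₀ (n % π) (m%n<n n π))
    where
    none⇒¬X : ∀ r → (∀ ℓ → ℓ₀ ≤ ℓ → ¬ ClassA.Reaches r ℓ (start A) 0) → ∀ n → U S ℓ₀ ≤ n → n % π ≡ r → ¬ X n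
    none⇒¬X r none n U≤n res Xn with rep n
    ... | w , g , l , refl = none (length w) (≮⇒≥ λ len< → <⇒≱ (Greedy⇒value< w g) (≤-trans (U-mono (<⇒≤ len<)) U≤n))
            (w , refl , Equivalence.to (Recognized⇔Accepts A A⊆rep w g l) Xn , res)
    none⇒X : ∀ r → (∀ ℓ → ℓ₀ ≤ ℓ → ¬ ClassB.Reaches r ℓ (start B) 0) → ∀ n → U S ℓ₀ ≤ n → n % π ≡ r → X n
    none⇒X r none n U≤n res with rep n
    -- Acceptance by `A` is decidable, so excluding rejection, which would put `w` in the language
    -- of `B`, really yields membership in X.
    ... | w , g , l , refl with final A (run A (start A) w) Bool.≟ true
    ...   | yes acc = Equivalence.from (Recognized⇔Accepts A A⊆rep w g l) acc
    ...   | no rejected = contradiction (w , refl , Accepts-B⇐ w (Greedy⇒InRep w g l) rejected , res)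
              (none (length w) (≮⇒≥ λ len< → <⇒≱ (Greedy⇒value< w g) (≤-trans (U-mono (<⇒≤ len<)) U≤n)))
    decide : ∀ n → U S ℓ₀ ≤ n → SettledFrom (n % π) ℓ₀ → X n ⇔ X (n + π)
    decide n U≤n (inj₁ none) = mk⇔ (λ Xn → contradiction Xn (none⇒¬X _ none n U≤n refl))
      (λ Xn+π → contradiction Xn+π (none⇒¬X _ none (n + π) (≤-trans U≤n (m≤m+n n π)) ([m+n]%n≡m%n n π)))
    decide n U≤n (inj₂ none) = mk⇔ (λ _ → none⇒X _ none (n + π) (≤-trans U≤n (m≤m+n n π)) ([m+n]%n≡m%n n π))
      (λ _ → none⇒X _ none n U≤n refl)

  eventualPeriod? : Dec (EventualPeriod X π)
  eventualPeriod? with firstCounterexample settled? π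
  ... | inj₁ settled                = yes (settled⇒period settled)
  ... | inj₂ (r , _ , unsettled , _) = no λ period → unsettled (period⇒settled period r)

-- The search for a period below the bound.

theorem5p1 : (S : LinearNumerationSystem) →
    gcdFin (suc (m S)) (a S) ≡ 1 →
    H1 S → H2 S → (G : ℕ) → H3 S G →
    (A : DFA (C S)) → (∀ w → Accepts A w → InRep S w) →
    Dec (UltimatelyPeriodic (Recognized S A))
theorem5p1 S gcd≡1 h1 h2 G h3 A A⊆rep with IntegerRecurrences.eventual-divisors-bounded S gcd≡1
... | R , divisor-bound = map′ (λ { (p , _ , 0<p , n₀ , period) → n₀ , p , 0<p , period })
                               (λ { (n₀ , p , 0<p , period) → PeriodBound.bounded-period S h2 G h3 R divisor-bound A A⊆rep p 0<p (n₀ , period) })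
                               (anyUpTo? positivePeriod? (suc (nStates A * R)))
  where
  positivePeriod? : ∀ p → Dec (0 < p × EventualPeriod (Recognized S A) p)
  positivePeriod? zero    = no λ { (() , _) }
  positivePeriod? (suc p) = map′ (z<s ,_) proj₂ (PeriodDecision.eventualPeriod? S h1 A A⊆rep (suc p))
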